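{- Let $\eta,\mu\ge 3$ and $m\ge 2$ be integers. Then the algebraic connectivity of $W'(\eta,\mu)\times K_m$ is $$(m-1)\left(\frac{\mu+\eta-\sqrt{(\mu+\eta)^2-4\eta}}{2}\right).$$
   Context: All graphs are finite and simple. The Laplacian matrix of a graph is its diagonal degree matrix minus its adjacency matrix; the algebraic connectivity of a graph is the second smallest eigenvalue (counted with multiplicity) of its Laplacian matrix. The Kronecker product $Y_1\times Y_2$ has vertex set $V(Y_1)\times V(Y_2)$, with $(y_1,y_2)$ and $(y_1',y_2')$ adjacent iff $y_1$ is adjacent to $y_1'$ in $Y_1$ and $y_2$ is adjacent to $y_2'$ in $Y_2$. $K_r$ is the complete graph on $r$ vertices. $W'(\eta,\mu)$ is the graph on $\eta\mu$ vertices obtained from the complete graph $K_\eta$ by attaching to each vertex $v$ of $K_\eta$ its own copy of $K_\mu$, that is, by identifying $v$ with one vertex of that copy (the copies being otherwise disjoint). -}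

module Defs where

open import Algebra.Bundles using (CommutativeMonoid)
open import Algebra.Bundles.Raw using (RawRing)
import Algebra.Definitions.RawMonoid as RawMonoidDefinitions
import Algebra.Properties.CommutativeSemigroup as CommutativeSemigroupProperties
import Algebra.Properties.Group as GroupProperties
open import Data.Bool.Base using (if_then_else_)
open import Data.Fin.Base using (Fin; toℕ)
import Data.Fin.Properties as Fin
open import Data.Integer.Base as ℤ using (+_)
import Data.Integer.Properties as ℤ
open import Data.Nat.Base as ℕ using (ℕ; zero; suc)
import Data.Nat.Properties as ℕ
open import Data.Product.Base using (_×_; _,_; ∃; ∃₂; proj₁; proj₂)
open import Data.Product.Function.NonDependent.Propositional using (_×-↔_)
open import Data.Rational.Base as ℚ using (ℚ; 0ℚ; 1ℚ; ½; ∣_∣)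
import Data.Rational.Properties as ℚ
open import Data.Rational.Unnormalised.Base as ℚᵘ using (mkℚᵘ)
import Data.Rational.Unnormalised.Properties as ℚᵘ
open import Data.Sum.Base using (_⊎_; inj₁; inj₂; [_,_]′)
open import Data.Vec.Base as Vec using (count)
open import Data.Vec.Functional using (Vector)
open import Function.Bundles using (_↔_; Inverse)
open import Function.Construct.Composition using (_↔-∘_)
open import Function.Construct.Identity using (↔-id)
open import Function.Construct.Symmetry using (↔-sym)
open import Level using (0ℓ)
open import Relation.Binary.Core using (Rel)
open import Relation.Binary.Definitions using (Decidable; Symmetric)
open import Relation.Binary.PropositionalEquality
  using (_≡_; _≢_; refl; sym; trans; cong; cong₂; subst; subst₂; ≢-sym; module ≡-Reasoning)
open import Relation.Nullary using (Dec; yes; no; does; ¬_; ¬?; contradiction)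
open import Relation.Nullary.Decidable using (_×-dec_; _⊎-dec_)

IsCauchy : (ℕ → ℚ) → Set
IsCauchy x = ∀ ε → 0ℚ ℚ.< ε →
  ∃ λ N → ∀ m n → N ℕ.≤ m → N ℕ.≤ n → ∣ x m ℚ.- x n ∣ ℚ.< ε

record ℝ : Set where
  constructor mkℝ
  field
    seq    : ℕ → ℚ
    cauchy : IsCauchy seq

open ℝ public

infix 4 _≈_ _≤_

_≈_ : Rel ℝ 0ℓ
x ≈ y = ∀ ε → 0ℚ ℚ.< ε → ∃ λ N → ∀ n → N ℕ.≤ n → ∣ seq x n ℚ.- seq y n ∣ ℚ.< ε

_≤_ : Rel ℝ 0ℓ
x ≤ y = ∀ ε → 0ℚ ℚ.< ε → ∃ λ N → ∀ n → N ℕ.≤ n → seq x n ℚ.< seq y n ℚ.+ ε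

mesh : ℕ → ℚ
mesh k = + 1 ℚ./ suc k

rootSearch : ℚ → ℚ → ℕ → ℚ
rootSearch q δ zero    = 0ℚ
rootSearch q δ (suc n) =
  let r = rootSearch q δ n ; r⁺ = r ℚ.+ δ in
  if does (r⁺ ℚ.* r⁺ ℚ.≤? q) then r⁺ else r

rootSteps : ℕ → ℚ → ℕ
rootSteps k q = suc ℤ.∣ ℚ.↥ q ∣ ℕ.* suc k

-- For q ≥ 0, the largest multiple r of 1/(1+k) with r² ≤ q, found by
-- counting upwards; r is less than |numerator of q| + 1, which bounds the
-- number of steps.  For q < 0 it is 0.
approxRoot : ℕ → ℚ → ℚ
approxRoot k q = rootSearch q (mesh k) (rootSteps k q)

abstract

  half>0 : ∀ {ε} → 0ℚ ℚ.< ε → 0ℚ ℚ.< ½ ℚ.* ε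
  half>0 {ε} 0<ε = subst (ℚ._< ½ ℚ.* ε) (ℚ.*-zeroʳ ½) (ℚ.*-monoʳ-<-pos ½ 0<ε)

  half+half : ∀ ε → ½ ℚ.* ε ℚ.+ ½ ℚ.* ε ≡ ε
  half+half ε = trans (sym (ℚ.*-distribʳ-+ ε ½ ½)) (ℚ.*-identityˡ ε)

  neg-difference : ∀ p q → (ℚ.- p) ℚ.- (ℚ.- q) ≡ ℚ.- (p ℚ.- q)
  neg-difference p q = sym (ℚ.neg-distrib-+ p (ℚ.- q))

  p+[q-p]≡q : ∀ p q → p ℚ.+ (q ℚ.- p) ≡ q
  p+[q-p]≡q p q = trans (cong (p ℚ.+_) (ℚ.+-comm q (ℚ.- p)))
    (trans (sym (ℚ.+-assoc p (ℚ.- p) q))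
    (trans (cong (ℚ._+ q) (ℚ.+-inverseʳ p)) (ℚ.+-identityˡ q)))

  +-difference : ∀ p q r s →
    (p ℚ.+ q) ℚ.- (r ℚ.+ s) ≡ (p ℚ.- r) ℚ.+ (q ℚ.- s)
  +-difference p q r s =
    trans (cong ((p ℚ.+ q) ℚ.+_) (ℚ.neg-distrib-+ r s))
          (interchange p q (ℚ.- r) (ℚ.- s))
    where
    open CommutativeSemigroupProperties
      (CommutativeMonoid.commutativeSemigroup ℚ.+-0-commutativeMonoid)

  *-difference : ∀ p q r s →
    p ℚ.* q ℚ.- r ℚ.* s ≡ p ℚ.* (q ℚ.- s) ℚ.+ s ℚ.* (p ℚ.- r)
  *-difference p q r s = sym (begin
    p ℚ.* (q ℚ.- s) ℚ.+ s ℚ.* (p ℚ.- r)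
      ≡⟨ cong₂ ℚ._+_ (distrib p q s)
           (trans (distrib s p r) (cong₂ ℚ._-_ (ℚ.*-comm s p) (ℚ.*-comm s r))) ⟩
    (p ℚ.* q ℚ.- p ℚ.* s) ℚ.+ (p ℚ.* s ℚ.- r ℚ.* s)
      ≡⟨ ℚ.+-comm (p ℚ.* q ℚ.- p ℚ.* s) (p ℚ.* s ℚ.- r ℚ.* s) ⟩
    (p ℚ.* s ℚ.- r ℚ.* s) ℚ.+ (p ℚ.* q ℚ.- p ℚ.* s)
      ≡⟨ cong (ℚ._+ (p ℚ.* q ℚ.- p ℚ.* s)) (ℚ.+-comm (p ℚ.* s) (ℚ.- (r ℚ.* s))) ⟩
    (ℚ.- (r ℚ.* s) ℚ.+ p ℚ.* s) ℚ.+ (p ℚ.* q ℚ.- p ℚ.* s)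
      ≡⟨ ℚ.+-assoc (ℚ.- (r ℚ.* s)) (p ℚ.* s) (p ℚ.* q ℚ.- p ℚ.* s) ⟩
    ℚ.- (r ℚ.* s) ℚ.+ (p ℚ.* s ℚ.+ (p ℚ.* q ℚ.- p ℚ.* s))
      ≡⟨ cong (ℚ.- (r ℚ.* s) ℚ.+_) (p+[q-p]≡q (p ℚ.* s) (p ℚ.* q)) ⟩
    ℚ.- (r ℚ.* s) ℚ.+ p ℚ.* q
      ≡⟨ ℚ.+-comm (ℚ.- (r ℚ.* s)) (p ℚ.* q) ⟩
    p ℚ.* q ℚ.- r ℚ.* s ∎)
    where
    open ≡-Reasoning
    distrib : ∀ a b c → a ℚ.* (b ℚ.- c) ≡ a ℚ.* b ℚ.- a ℚ.* c
    distrib a b c = trans (ℚ.*-distribˡ-+ a b (ℚ.- c))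
      (cong (a ℚ.* b ℚ.+_) (sym (ℚ.neg-distribʳ-* a c)))

  const-cauchy : ∀ q → IsCauchy (λ _ → q)
  const-cauchy q ε 0<ε = 0 , λ _ _ _ _ →
    subst (ℚ._< ε) (sym (cong ∣_∣ (ℚ.+-inverseʳ q))) 0<ε

  neg-cauchy : ∀ {x} → IsCauchy x → IsCauchy (λ n → ℚ.- x n)
  neg-cauchy {x} cx ε 0<ε with cx ε 0<ε
  ... | N , close = N , λ m n N≤m N≤n →
    subst (ℚ._< ε)
      (sym (trans (cong ∣_∣ (neg-difference (x m) (x n))) (ℚ.∣-p∣≡∣p∣ (x m ℚ.- x n))))
      (close m n N≤m N≤n)

  +-cauchy : ∀ {x y} → IsCauchy x → IsCauchy y → IsCauchy (λ n → x n ℚ.+ y n)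
  +-cauchy {x} {y} cx cy ε 0<ε
    with cx (½ ℚ.* ε) (half>0 0<ε) | cy (½ ℚ.* ε) (half>0 0<ε)
  ... | N , closeˣ | M , closeʸ = N ℕ.⊔ M , λ m n N≤m N≤n → begin-strict
    ∣ (x m ℚ.+ y m) ℚ.- (x n ℚ.+ y n) ∣
      ≡⟨ cong ∣_∣ (+-difference (x m) (y m) (x n) (y n)) ⟩
    ∣ (x m ℚ.- x n) ℚ.+ (y m ℚ.- y n) ∣
      ≤⟨ ℚ.∣p+q∣≤∣p∣+∣q∣ (x m ℚ.- x n) (y m ℚ.- y n) ⟩
    ∣ x m ℚ.- x n ∣ ℚ.+ ∣ y m ℚ.- y n ∣
      <⟨ ℚ.+-mono-< (closeˣ m n (ℕ.m⊔n≤o⇒m≤o N M N≤m) (ℕ.m⊔n≤o⇒m≤o N M N≤n))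
                    (closeʸ m n (ℕ.m⊔n≤o⇒n≤o N M N≤m) (ℕ.m⊔n≤o⇒n≤o N M N≤n)) ⟩
    ½ ℚ.* ε ℚ.+ ½ ℚ.* ε
      ≡⟨ half+half ε ⟩
    ε ∎
    where open ℚ.≤-Reasoning

  eventually-bounded : ∀ {x} → IsCauchy x →
    ∃₂ λ N b → 0ℚ ℚ.< b × (∀ n → N ℕ.≤ n → ∣ x n ∣ ℚ.< b)
  eventually-bounded {x} cx with cx 1ℚ (ℚ.positive⁻¹ 1ℚ)
  ... | N , close = N , b , 0<b , λ n N≤n → begin-strict
    ∣ x n ∣
      ≡⟨ cong ∣_∣ (sym (p+[q-p]≡q (x N) (x n))) ⟩
    ∣ x N ℚ.+ (x n ℚ.- x N) ∣
      ≤⟨ ℚ.∣p+q∣≤∣p∣+∣q∣ (x N) (x n ℚ.- x N) ⟩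
    ∣ x N ∣ ℚ.+ ∣ x n ℚ.- x N ∣
      <⟨ ℚ.+-monoʳ-< ∣ x N ∣ (close n N N≤n ℕ.≤-refl) ⟩
    b ∎
    where
    open ℚ.≤-Reasoning
    b : ℚ
    b = ∣ x N ∣ ℚ.+ 1ℚ
    0<b : 0ℚ ℚ.< b
    0<b = ℚ.+-mono-≤-< (ℚ.0≤∣p∣ (x N)) (ℚ.positive⁻¹ 1ℚ)

  divide : ∀ ε b → 0ℚ ℚ.< ε → 0ℚ ℚ.< b → ∃ λ η → 0ℚ ℚ.< η × b ℚ.* η ≡ ε
  divide ε b 0<ε 0<b = η , ℚ.positive⁻¹ η {{η-pos}} , b*η≡ε
    where
    instance
      b-pos : ℚ.Positive b
      b-pos = ℚ.positive 0<b
      ε-pos : ℚ.Positive ε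
      ε-pos = ℚ.positive 0<ε
      b≢0 : ℚ.NonZero b
      b≢0 = ℚ.pos⇒nonZero b
    η : ℚ
    η = ℚ.1/ b ℚ.* ε
    η-pos : ℚ.Positive η
    η-pos = ℚ.pos*pos⇒pos (ℚ.1/ b) {{ℚ.1/pos⇒pos b}} ε
    b*η≡ε : b ℚ.* η ≡ ε
    b*η≡ε = trans (sym (ℚ.*-assoc b (ℚ.1/ b) ε))
           (trans (cong (ℚ._* ε) (ℚ.*-inverseʳ b)) (ℚ.*-identityˡ ε))

  *-bound : ∀ {p b q η} → 0ℚ ℚ.< b → ∣ p ∣ ℚ.< b → ∣ q ∣ ℚ.< η →
            ∣ p ∣ ℚ.* ∣ q ∣ ℚ.< b ℚ.* η
  *-bound {p} {b} {q} {η} 0<b p<b q<η = ℚ.≤-<-trans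
    (ℚ.*-monoʳ-≤-nonNeg ∣ q ∣ {{ℚ.∣-∣-nonNeg q}} (ℚ.<⇒≤ p<b))
    (ℚ.*-monoʳ-<-pos b {{ℚ.positive 0<b}} q<η)

  *-cauchy : ∀ {x y} → IsCauchy x → IsCauchy y → IsCauchy (λ n → x n ℚ.* y n)
  *-cauchy {x} {y} cx cy ε 0<ε
    with eventually-bounded cx | eventually-bounded cy
  ... | N₁ , b , 0<b , x<b | N₂ , c , 0<c , y<c
    with divide (½ ℚ.* ε) b (half>0 0<ε) 0<b | divide (½ ℚ.* ε) c (half>0 0<ε) 0<c
  ... | η , 0<η , bη≡ | θ , 0<θ , cθ≡
    with cy η 0<η | cx θ 0<θ
  ... | N₃ , closeʸ | N₄ , closeˣ = (N₁ ℕ.⊔ N₂) ℕ.⊔ (N₃ ℕ.⊔ N₄) , λ m n N≤m N≤n →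
    let
      m₁₂ = ℕ.m⊔n≤o⇒m≤o (N₁ ℕ.⊔ N₂) (N₃ ℕ.⊔ N₄) N≤m
      m₃₄ = ℕ.m⊔n≤o⇒n≤o (N₁ ℕ.⊔ N₂) (N₃ ℕ.⊔ N₄) N≤m
      n₁₂ = ℕ.m⊔n≤o⇒m≤o (N₁ ℕ.⊔ N₂) (N₃ ℕ.⊔ N₄) N≤n
      n₃₄ = ℕ.m⊔n≤o⇒n≤o (N₁ ℕ.⊔ N₂) (N₃ ℕ.⊔ N₄) N≤n
    in begin-strict
    ∣ x m ℚ.* y m ℚ.- x n ℚ.* y n ∣
      ≡⟨ cong ∣_∣ (*-difference (x m) (y m) (x n) (y n)) ⟩
    ∣ x m ℚ.* (y m ℚ.- y n) ℚ.+ y n ℚ.* (x m ℚ.- x n) ∣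
      ≤⟨ ℚ.∣p+q∣≤∣p∣+∣q∣ (x m ℚ.* (y m ℚ.- y n)) (y n ℚ.* (x m ℚ.- x n)) ⟩
    ∣ x m ℚ.* (y m ℚ.- y n) ∣ ℚ.+ ∣ y n ℚ.* (x m ℚ.- x n) ∣
      ≡⟨ cong₂ ℚ._+_ (ℚ.∣p*q∣≡∣p∣*∣q∣ (x m) (y m ℚ.- y n))
                     (ℚ.∣p*q∣≡∣p∣*∣q∣ (y n) (x m ℚ.- x n)) ⟩
    ∣ x m ∣ ℚ.* ∣ y m ℚ.- y n ∣ ℚ.+ ∣ y n ∣ ℚ.* ∣ x m ℚ.- x n ∣
      <⟨ ℚ.+-mono-<
           (*-bound {x m} {b} {y m ℚ.- y n} 0<b (x<b m (ℕ.m⊔n≤o⇒m≤o N₁ N₂ m₁₂))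
             (closeʸ m n (ℕ.m⊔n≤o⇒m≤o N₃ N₄ m₃₄) (ℕ.m⊔n≤o⇒m≤o N₃ N₄ n₃₄)))
           (*-bound {y n} {c} {x m ℚ.- x n} 0<c (y<c n (ℕ.m⊔n≤o⇒n≤o N₁ N₂ n₁₂))
             (closeˣ m n (ℕ.m⊔n≤o⇒n≤o N₃ N₄ m₃₄) (ℕ.m⊔n≤o⇒n≤o N₃ N₄ n₃₄))) ⟩
    b ℚ.* η ℚ.+ c ℚ.* θ
      ≡⟨ cong₂ ℚ._+_ bη≡ cθ≡ ⟩
    ½ ℚ.* ε ℚ.+ ½ ℚ.* ε
      ≡⟨ half+half ε ⟩
    ε ∎
    where open ℚ.≤-Reasoning

  square-mono : ∀ {p q} → 0ℚ ℚ.≤ p → p ℚ.≤ q → p ℚ.* p ℚ.≤ q ℚ.* q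
  square-mono {p} {q} 0≤p p≤q = ℚ.≤-trans
    (ℚ.*-monoˡ-≤-nonNeg p {{ℚ.nonNegative 0≤p}} p≤q)
    (ℚ.*-monoʳ-≤-nonNeg q {{ℚ.nonNegative (ℚ.≤-trans 0≤p p≤q)}} p≤q)

  mesh>0 : ∀ k → 0ℚ ℚ.< mesh k
  mesh>0 k = ℚ.positive⁻¹ (mesh k) {{ℚ.normalize-pos 1 (suc k)}}

  mesh-antitone : ∀ {j k} → j ℕ.≤ k → mesh k ℚ.≤ mesh j
  mesh-antitone {j} {k} j≤k = ℚ.toℚᵘ-cancel-≤
    (ℚᵘ.≤-respˡ-≃ (ℚᵘ.≃-sym (ℚ.toℚᵘ-fromℚᵘ (mkℚᵘ (+ 1) k)))
    (ℚᵘ.≤-respʳ-≃ (ℚᵘ.≃-sym (ℚ.toℚᵘ-fromℚᵘ (mkℚᵘ (+ 1) j)))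
    (ℚᵘ.*≤* (ℤ.*-monoˡ-≤-nonNeg (+ 1) {+ suc j} {+ suc k} (ℤ.+≤+ (ℕ.s≤s j≤k))))))

  archimedean : ∀ {ε} → 0ℚ ℚ.< ε → ∃ λ k → mesh k ℚ.≤ ε
  archimedean {ε@(ℚ.mkℚ (+ suc p) d _)} _ = d , ℚ.toℚᵘ-cancel-≤
    (ℚᵘ.≤-respˡ-≃ (ℚᵘ.≃-sym (ℚ.toℚᵘ-fromℚᵘ (mkℚᵘ (+ 1) d)))
    (ℚᵘ.*≤* (ℤ.*-monoʳ-≤-nonNeg (+ suc d) {+ 1} {+ suc p} (ℤ.+≤+ (ℕ.s≤s ℕ.z≤n)))))
  archimedean {ε@(ℚ.mkℚ (+ zero) d _)} (ℚ.*<* (ℤ.+<+ ()))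
  archimedean {ε@(ℚ.mkℚ ℤ.-[1+ p ] d _)} (ℚ.*<* ())

  mesh-suc : ∀ n k → (+ n ℚ./ suc k) ℚ.+ mesh k ≡ + suc n ℚ./ suc k
  mesh-suc n k = ℚ.toℚᵘ-injective
    (ℚᵘ.≃-trans (ℚ.toℚᵘ-homo-+ (+ n ℚ./ suc k) (mesh k))
    (ℚᵘ.≃-trans (ℚᵘ.+-cong (ℚ.toℚᵘ-fromℚᵘ (mkℚᵘ (+ n) k)) (ℚ.toℚᵘ-fromℚᵘ (mkℚᵘ (+ 1) k)))
    (ℚᵘ.≃-trans sum≃ (ℚᵘ.≃-sym (ℚ.toℚᵘ-fromℚᵘ (mkℚᵘ (+ suc n) k))))))
    where
    K : ℤ.ℤ
    K = + suc k
    sum≃ : mkℚᵘ (+ n) k ℚᵘ.+ mkℚᵘ (+ 1) k ℚᵘ.≃ mkℚᵘ (+ suc n) k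
    sum≃ = ℚᵘ.*≡* (trans
      (cong (ℤ._* K) (trans (sym (ℤ.*-distribʳ-+ K (+ n) (+ 1)))
                            (cong (λ i → + i ℤ.* K) (ℕ.+-comm n 1))))
      (trans (ℤ.*-assoc (+ suc n) K K) refl))

  steps-enough : ∀ k q → q ℚ.< + rootSteps k q ℚ./ suc k
  steps-enough k q@record{} = ℚ.toℚᵘ-cancel-<
    (ℚᵘ.<-respʳ-≃ (ℚᵘ.≃-sym (ℚ.toℚᵘ-fromℚᵘ (mkℚᵘ (+ rootSteps k q) k)))
    (ℚᵘ.*<* (begin-strict
      ℚ.↥ q ℤ.* + suc k
        ≤⟨ ℤ.*-monoʳ-≤-nonNeg (+ suc k) {ℚ.↥ q} {+ ℤ.∣ ℚ.↥ q ∣} i≤∣i∣ ⟩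
      + ℤ.∣ ℚ.↥ q ∣ ℤ.* + suc k
        <⟨ ℤ.*-monoʳ-<-pos (+ suc k) {+ ℤ.∣ ℚ.↥ q ∣} {+ suc ℤ.∣ ℚ.↥ q ∣} (ℤ.+<+ ℕ.≤-refl) ⟩
      + suc ℤ.∣ ℚ.↥ q ∣ ℤ.* + suc k
        ≡⟨ ℤ.pos-* (suc ℤ.∣ ℚ.↥ q ∣) (suc k) ⟨
      + rootSteps k q
        ≡⟨ ℤ.*-identityʳ (+ rootSteps k q) ⟨
      + rootSteps k q ℤ.* + 1
        ≤⟨ ℤ.*-monoˡ-≤-nonNeg (+ rootSteps k q) {+ 1} {ℚ.↧ q} (ℤ.+≤+ (ℕ.s≤s ℕ.z≤n)) ⟩
      + rootSteps k q ℤ.* ℚ.↧ q ∎)))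
    where
    open ℤ.≤-Reasoning
    i≤∣i∣ : ∀ {i} → i ℤ.≤ + ℤ.∣ i ∣
    i≤∣i∣ {+ n}        = ℤ.≤-refl
    i≤∣i∣ {ℤ.-[1+ n ]} = ℤ.-≤+

  p≤p+q : ∀ p {q} → 0ℚ ℚ.≤ q → p ℚ.≤ p ℚ.+ q
  p≤p+q p {q} 0≤q = subst (ℚ._≤ p ℚ.+ q) (ℚ.+-identityʳ p) (ℚ.+-monoʳ-≤ p 0≤q)

  SearchSpec : (q δ nδ r : ℚ) → Set
  SearchSpec q δ nδ r =
    0ℚ ℚ.≤ r × (r ≡ 0ℚ ⊎ r ℚ.* r ℚ.≤ q) × (r ≡ nδ ⊎ q ℚ.< (r ℚ.+ δ) ℚ.* (r ℚ.+ δ))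

  step-spec : ∀ q δ nδ r → 0ℚ ℚ.≤ δ → (d : Dec ((r ℚ.+ δ) ℚ.* (r ℚ.+ δ) ℚ.≤ q)) →
    SearchSpec q δ nδ r → SearchSpec q δ (nδ ℚ.+ δ) (if does d then r ℚ.+ δ else r)
  step-spec q δ nδ r 0≤δ (no r⁺²≰q) (0≤r , r²≤q , _) = 0≤r , r²≤q , inj₂ (ℚ.≰⇒> r⁺²≰q)
  step-spec q δ nδ r 0≤δ (yes r⁺²≤q) (0≤r , _ , upper) =
    ℚ.≤-trans 0≤r (p≤p+q r 0≤δ) , inj₂ r⁺²≤q ,
    [ (λ r≡nδ → inj₁ (cong (ℚ._+ δ) r≡nδ))
    , (λ q<r⁺² → contradiction (ℚ.<-≤-trans q<r⁺² r⁺²≤q) (ℚ.<-irrefl refl)) ]′ upper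

  search-spec : ∀ q δ (multiple : ℕ → ℚ) → 0ℚ ℚ.≤ δ → 0ℚ ≡ multiple 0 →
    (∀ n → multiple n ℚ.+ δ ≡ multiple (suc n)) →
    ∀ n → SearchSpec q δ (multiple n) (rootSearch q δ n)
  search-spec q δ multiple 0≤δ base next zero = ℚ.≤-refl , inj₁ refl , inj₁ base
  search-spec q δ multiple 0≤δ base next (suc n) =
    subst (λ nδ → SearchSpec q δ nδ (rootSearch q δ (suc n))) (next n)
      (step-spec q δ (multiple n) (rootSearch q δ n) 0≤δ (r⁺ ℚ.* r⁺ ℚ.≤? q)
        (search-spec q δ multiple 0≤δ base next n))
    where
    r⁺ : ℚ
    r⁺ = rootSearch q δ n ℚ.+ δ

  approxRoot-spec : ∀ k q →
    SearchSpec q (mesh k) (+ rootSteps k q ℚ./ suc k) (approxRoot k q)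
  approxRoot-spec k q = search-spec q (mesh k) (λ n → + n ℚ./ suc k)
    (ℚ.<⇒≤ (mesh>0 k)) (sym (ℚ.0/n≡0 (suc k))) (λ n → mesh-suc n k) (rootSteps k q)

  1≤steps : ∀ k q → 1ℚ ℚ.≤ + rootSteps k q ℚ./ suc k
  1≤steps k q = ℚ.toℚᵘ-cancel-≤
    (ℚᵘ.≤-respʳ-≃ (ℚᵘ.≃-sym (ℚ.toℚᵘ-fromℚᵘ (mkℚᵘ (+ rootSteps k q) k)))
    (ℚᵘ.*≤* (subst₂ ℤ._≤_ (sym (ℤ.*-identityˡ (+ suc k)))
                          (sym (ℤ.*-identityʳ (+ rootSteps k q)))
                          (ℤ.+≤+ (ℕ.m≤m+n (suc k) _)))))

  spec-upper : ∀ {q δ t r} → 0ℚ ℚ.≤ δ → 1ℚ ℚ.≤ t → q ℚ.< t →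
    SearchSpec q δ t r → q ℚ.< (r ℚ.+ δ) ℚ.* (r ℚ.+ δ)
  spec-upper _ _ _ (_ , _ , inj₂ q<r⁺²) = q<r⁺²
  spec-upper {q} {δ} {t} 0≤δ 1≤t q<t (_ , _ , inj₁ refl) = begin-strict
    q                      <⟨ q<t ⟩
    t                      ≡⟨ ℚ.*-identityʳ t ⟨
    t ℚ.* 1ℚ               ≤⟨ ℚ.*-monoˡ-≤-nonNeg t {{ℚ.nonNegative 0≤t}} 1≤t ⟩
    t ℚ.* t                ≤⟨ square-mono 0≤t (p≤p+q t 0≤δ) ⟩
    (t ℚ.+ δ) ℚ.* (t ℚ.+ δ) ∎
    where
    open ℚ.≤-Reasoning
    0≤t : 0ℚ ℚ.≤ t
    0≤t = ℚ.≤-trans (ℚ.nonNegative⁻¹ 1ℚ) 1≤t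

  approxRoot≥0 : ∀ k q → 0ℚ ℚ.≤ approxRoot k q
  approxRoot≥0 k q = proj₁ (approxRoot-spec k q)

  approxRoot-lower : ∀ k q → let r = approxRoot k q in r ≡ 0ℚ ⊎ r ℚ.* r ℚ.≤ q
  approxRoot-lower k q = proj₁ (proj₂ (approxRoot-spec k q))

  approxRoot-upper : ∀ k q → let r⁺ = approxRoot k q ℚ.+ mesh k in q ℚ.< r⁺ ℚ.* r⁺
  approxRoot-upper k q = spec-upper (ℚ.<⇒≤ (mesh>0 k)) (1≤steps k q) (steps-enough k q)
    (approxRoot-spec k q)

  p≤∣p∣ : ∀ p → p ℚ.≤ ∣ p ∣
  p≤∣p∣ p with ℚ.≤-total 0ℚ p
  ... | inj₁ 0≤p = ℚ.≤-reflexive (sym (ℚ.0≤p⇒∣p∣≡p 0≤p))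
  ... | inj₂ p≤0 = ℚ.≤-trans p≤0 (ℚ.0≤∣p∣ p)

  difference<⇒< : ∀ {p q r} → p ℚ.- q ℚ.< r → p ℚ.< q ℚ.+ r
  difference<⇒< {p} {q} {r} p-q<r =
    subst (ℚ._< q ℚ.+ r) (p+[q-p]≡q q p) (ℚ.+-monoʳ-< q p-q<r)

  <⇒difference< : ∀ {p q r} → p ℚ.< q ℚ.+ r → p ℚ.- q ℚ.< r
  <⇒difference< {p} {q} {r} p<q+r = begin-strict
    p ℚ.- q              <⟨ ℚ.+-monoˡ-< (ℚ.- q) p<q+r ⟩
    q ℚ.+ r ℚ.- q        ≡⟨ ℚ.+-assoc q r (ℚ.- q) ⟩
    q ℚ.+ (r ℚ.- q)      ≡⟨ p+[q-p]≡q q r ⟩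
    r ∎
    where open ℚ.≤-Reasoning

  ∣-∣-from-both : ∀ {p q r} → p ℚ.< q ℚ.+ r → q ℚ.< p ℚ.+ r → ∣ p ℚ.- q ∣ ℚ.< r
  ∣-∣-from-both {p} {q} {r} p<q+r q<p+r with ℚ.∣p∣≡p∨∣p∣≡-p (p ℚ.- q)
  ... | inj₁ ≡+ = subst (ℚ._< r) (sym ≡+) (<⇒difference< {p} {q} p<q+r)
  ... | inj₂ ≡- = subst (ℚ._< r) (trans (sym -[p-q]≡q-p) (sym ≡-))
                        (<⇒difference< {q} {p} q<p+r)
    where
    -[p-q]≡q-p : ℚ.- (p ℚ.- q) ≡ q ℚ.- p
    -[p-q]≡q-p = trans (ℚ.neg-distrib-+ p (ℚ.- q))
                (trans (cong ((ℚ.- p) ℚ.+_) (GroupProperties.⁻¹-involutive ℚ.+-0-group q)) (ℚ.+-comm (ℚ.- p) q))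

  roots-close : ∀ {a b s t δ h} → 0ℚ ℚ.< h → δ ℚ.≤ h → 0ℚ ℚ.≤ δ → 0ℚ ℚ.≤ t →
    s ≡ 0ℚ ⊎ s ℚ.* s ℚ.≤ a → b ℚ.< (t ℚ.+ δ) ℚ.* (t ℚ.+ δ) →
    ∣ a ℚ.- b ∣ ℚ.< h ℚ.* h → s ℚ.< t ℚ.+ (h ℚ.+ h)
  roots-close {a} {b} {s} {t} {δ} {h} 0<h δ≤h 0≤δ 0≤t lower upper close
    with s ℚ.<? t ℚ.+ (h ℚ.+ h)
  ... | yes s<t+2h = s<t+2h
  ... | no s≮t+2h = contradiction refl (ℚ.<⇒≢ (absurd lower))
    where
    open ℚ.≤-Reasoning
    u : ℚ
    u = t ℚ.+ h
    0≤u : 0ℚ ℚ.≤ u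
    0≤u = ℚ.+-mono-≤ 0≤t (ℚ.<⇒≤ 0<h)
    0<u+h : 0ℚ ℚ.< u ℚ.+ h
    0<u+h = ℚ.+-mono-≤-< 0≤u 0<h
    u+h≤s : u ℚ.+ h ℚ.≤ s
    u+h≤s = subst (ℚ._≤ s) (sym (ℚ.+-assoc t h h)) (ℚ.≮⇒≥ s≮t+2h)
    absurd : s ≡ 0ℚ ⊎ s ℚ.* s ℚ.≤ a → s ℚ.< s
    absurd (inj₁ s≡0) = begin-strict
      s        ≡⟨ s≡0 ⟩
      0ℚ       <⟨ 0<u+h ⟩
      u ℚ.+ h  ≤⟨ u+h≤s ⟩
      s        ∎
    absurd (inj₂ s²≤a) = contradiction a<a (ℚ.<-irrefl refl)
      where
      a<a : a ℚ.< a
      a<a = begin-strict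
        a
          <⟨ difference<⇒< {a} {b} (ℚ.≤-<-trans (p≤∣p∣ (a ℚ.- b)) close) ⟩
        b ℚ.+ h ℚ.* h
          ≤⟨ ℚ.+-monoˡ-≤ (h ℚ.* h) (ℚ.≤-trans (ℚ.<⇒≤ upper)
               (square-mono (ℚ.+-mono-≤ 0≤t 0≤δ) (ℚ.+-monoʳ-≤ t δ≤h))) ⟩
        u ℚ.* u ℚ.+ h ℚ.* h
          ≤⟨ ℚ.+-mono-≤
               (ℚ.*-monoˡ-≤-nonNeg u {{ℚ.nonNegative 0≤u}} u≤u+h)
               (ℚ.*-monoˡ-≤-nonNeg h {{ℚ.nonNegative (ℚ.<⇒≤ 0<h)}} h≤u+h) ⟩
        u ℚ.* (u ℚ.+ h) ℚ.+ h ℚ.* (u ℚ.+ h)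
          ≡⟨ ℚ.*-distribʳ-+ (u ℚ.+ h) u h ⟨
        (u ℚ.+ h) ℚ.* (u ℚ.+ h)
          ≤⟨ square-mono (ℚ.<⇒≤ 0<u+h) u+h≤s ⟩
        s ℚ.* s
          ≤⟨ s²≤a ⟩
        a ∎
        where
        u≤u+h : u ℚ.≤ u ℚ.+ h
        u≤u+h = p≤p+q u (ℚ.<⇒≤ 0<h)
        h≤u+h : h ℚ.≤ u ℚ.+ h
        h≤u+h = subst (ℚ._≤ u ℚ.+ h) (ℚ.+-identityˡ h) (ℚ.+-monoˡ-≤ h 0≤u)

  √-cauchy : ∀ {x} → IsCauchy x → IsCauchy (λ n → approxRoot n (x n))
  √-cauchy {x} cx ε 0<ε
    with archimedean (half>0 0<ε)
       | cx (½ ℚ.* ε ℚ.* (½ ℚ.* ε))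
            (ℚ.positive⁻¹ _ {{ℚ.pos*pos⇒pos (½ ℚ.* ε) {{ℚ.positive (half>0 0<ε)}}
                                            (½ ℚ.* ε) {{ℚ.positive (half>0 0<ε)}}}})
  ... | K , meshK≤h | N , close = K ℕ.⊔ N , λ m n K⊔N≤m K⊔N≤n →
    subst (∣ approxRoot m (x m) ℚ.- approxRoot n (x n) ∣ ℚ.<_) (half+half ε)
      (∣-∣-from-both
        (one-sided m n (ℕ.m⊔n≤o⇒n≤o K N K⊔N≤m) K⊔N≤n)
        (one-sided n m (ℕ.m⊔n≤o⇒n≤o K N K⊔N≤n) K⊔N≤m))
    where
    one-sided : ∀ m n → N ℕ.≤ m → K ℕ.⊔ N ℕ.≤ n →
      approxRoot m (x m) ℚ.< approxRoot n (x n) ℚ.+ (½ ℚ.* ε ℚ.+ ½ ℚ.* ε)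
    one-sided m n N≤m K⊔N≤n = roots-close {a = x m} {b = x n} {δ = mesh n}
      (half>0 0<ε)
      (ℚ.≤-trans (mesh-antitone (ℕ.m⊔n≤o⇒m≤o K N K⊔N≤n)) meshK≤h)
      (ℚ.<⇒≤ (mesh>0 n))
      (approxRoot≥0 n (x n))
      (approxRoot-lower m (x m))
      (approxRoot-upper n (x n))
      (close m n N≤m (ℕ.m⊔n≤o⇒n≤o K N K⊔N≤n))

infix  9 √_
infix  8 -_
infixl 7 _*_ _/_
infixl 6 _+_ _-_

fromℚ : ℚ → ℝ
fromℚ q = mkℝ (λ _ → q) (const-cauchy q)

fromℕ : ℕ → ℝ
fromℕ n = fromℚ (+ n ℚ./ 1)

0ℝ 1ℝ : ℝ
0ℝ = fromℚ 0ℚ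
1ℝ = fromℚ 1ℚ

-_ : ℝ → ℝ
- x = mkℝ (λ n → ℚ.- seq x n) (neg-cauchy {seq x} (cauchy x))

_+_ _*_ _-_ : ℝ → ℝ → ℝ
x + y = mkℝ (λ n → seq x n ℚ.+ seq y n) (+-cauchy {seq x} {seq y} (cauchy x) (cauchy y))
x * y = mkℝ (λ n → seq x n ℚ.* seq y n) (*-cauchy {seq x} {seq y} (cauchy x) (cauchy y))
x - y = x + - y

_/_ : ℝ → (n : ℕ) .{{_ : ℕ.NonZero n}} → ℝ
x / n = x * fromℚ (+ 1 ℚ./ n)

-- √ x = 0 for x ≤ 0.
√_ : ℝ → ℝ
√ x = mkℝ (λ n → approxRoot n (seq x n)) (√-cauchy {seq x} (cauchy x))

ℝ-rawRing : RawRing 0ℓ 0ℓ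
ℝ-rawRing = record
  { Carrier = ℝ ; _≈_ = _≈_ ; _+_ = _+_ ; _*_ = _*_ ; -_ = -_ ; 0# = 0ℝ ; 1# = 1ℝ }

open RawMonoidDefinitions (RawRing.+-rawMonoid ℝ-rawRing) public using (sum)

Matrix : ℕ → Set
Matrix n = Fin n → Fin n → ℝ

_·_ : ∀ {n} → Matrix n → Vector ℝ n → Vector ℝ n
(M · v) i = sum λ j → M i j * v j

combination : ∀ {n} → Vector ℝ n → (Fin n → Vector ℝ n) → Vector ℝ n
combination c b k = sum λ i → c i * b i k

record IsBasis {n} (b : Fin n → Vector ℝ n) : Set where
  field
    independent : ∀ (c : Vector ℝ n) → (∀ k → combination c b k ≈ 0ℝ) → ∀ i → c i ≈ 0ℝ
    spanning    : ∀ (v : Vector ℝ n) → ∃ λ (c : Vector ℝ n) → ∀ k → v k ≈ combination c b k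

-- A real symmetric matrix is diagonalizable, so its eigenvalues counted with
-- multiplicity are the family λs attached to a basis of eigenvectors: each
-- eigenvalue occurs in λs as often as the dimension of its eigenspace.
record IsSpectrum {n} (M : Matrix n) (λs : Vector ℝ n) : Set where
  field
    eigenvector   : Fin n → Vector ℝ n
    isBasis       : IsBasis eigenvector
    isEigenvector : ∀ i k → (M · eigenvector i) k ≈ λs i * eigenvector i k

-- The order on ℝ is undecidable, so the family is not sorted: i is a position
-- of a smallest entry, and j of a smallest entry among the others.
SecondSmallest : ∀ {n} → Vector ℝ n → ℝ → Set
SecondSmallest λs a = ∃₂ λ i j →
  j ≢ i × λs i ≤ λs j × (∀ k → k ≢ i → λs j ≤ λs k) × a ≈ λs j

record Graph : Set₁ where
  field
    Vertex   : Set
    order    : ℕ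
    vertices : Vertex ↔ Fin order
    Adj      : Rel Vertex 0ℓ
    adj?     : Decidable Adj
    adj-sym  : Symmetric Adj
    loopless : ∀ {u} → ¬ Adj u u

  vertex : Fin order → Vertex
  vertex = Inverse.from vertices

  degree : Vertex → ℕ
  degree u = count (adj? u) (Vec.tabulate vertex)

open Graph

degreeMatrix adjacencyMatrix laplacian : (G : Graph) → Matrix (order G)
degreeMatrix G i j =
  if does (i Fin.≟ j) then fromℕ (degree G (vertex G i)) else 0ℝ
adjacencyMatrix G i j =
  if does (adj? G (vertex G i) (vertex G j)) then 1ℝ else 0ℝ
laplacian G i j = degreeMatrix G i j - adjacencyMatrix G i j

IsAlgebraicConnectivity : Graph → ℝ → Set
IsAlgebraicConnectivity G a =
  ∃ λ λs → IsSpectrum (laplacian G) λs × SecondSmallest λs a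

infixl 7 _×ᴷ_

_×ᴷ_ : Graph → Graph → Graph
Y₁ ×ᴷ Y₂ = record
  { Vertex   = Vertex Y₁ × Vertex Y₂
  ; order    = order Y₁ ℕ.* order Y₂
  ; vertices = ↔-sym Fin.*↔× ↔-∘ (vertices Y₁ ×-↔ vertices Y₂)
  ; Adj      = λ (u₁ , u₂) (v₁ , v₂) → Adj Y₁ u₁ v₁ × Adj Y₂ u₂ v₂
  ; adj?     = λ (u₁ , u₂) (v₁ , v₂) → adj? Y₁ u₁ v₁ ×-dec adj? Y₂ u₂ v₂
  ; adj-sym  = λ (e₁ , e₂) → adj-sym Y₁ e₁ , adj-sym Y₂ e₂
  ; loopless = λ (e₁ , _) → loopless Y₁ e₁
  }

K : ℕ → Graph
K r = record
  { Vertex   = Fin r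
  ; order    = r
  ; vertices = ↔-id (Fin r)
  ; Adj      = _≢_
  ; adj?     = λ u v → ¬? (u Fin.≟ v)
  ; adj-sym  = ≢-sym
  ; loopless = λ u≢u → u≢u refl
  }

-- The vertex (v , a) is vertex a of the copy of K μ attached to the vertex v of
-- K η; vertex 0 of that copy is the one identified with v.  So two vertices are
-- adjacent if they are distinct vertices of the same copy, or if they are the
-- 0-th vertices of different copies.
W′ : ℕ → ℕ → Graph
W′ η μ = record
  { Vertex   = Fin η × Fin μ
  ; order    = η ℕ.* μ
  ; vertices = ↔-sym Fin.*↔×
  ; Adj      = λ (u , a) (v , b) →
                 (u ≡ v × a ≢ b) ⊎ (u ≢ v × toℕ a ≡ 0 × toℕ b ≡ 0)
  ; adj?     = λ (u , a) (v , b) →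
                 (u Fin.≟ v ×-dec ¬? (a Fin.≟ b))
                 ⊎-dec (¬? (u Fin.≟ v) ×-dec toℕ a ℕ.≟ 0 ×-dec toℕ b ℕ.≟ 0)
  ; adj-sym  = λ where
      (inj₁ (u≡v , a≢b))       → inj₁ (sym u≡v , ≢-sym a≢b)
      (inj₂ (u≢v , a≡0 , b≡0)) → inj₂ (≢-sym u≢v , b≡0 , a≡0)
  ; loopless = λ where
      (inj₁ (_ , a≢a))     → a≢a refl
      (inj₂ (u≢u , _ , _)) → u≢u refl
  }

-- With c = m - 1, the Laplacian of W′ × K_m is c D ⊗ I - A ⊗ (J - I), where D and A
-- are the degree and adjacency matrices of W′.  On x ⊗ w ⊗ y, with x and y
-- eigenvectors of K_η and K_m for θ and κ, it acts on w ∈ ℝ^μ alone: the vectors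
-- that vanish at the root and have sum 0 are eigenvectors for c(μ-1) + κ, and the
-- two remaining eigenvalues are the roots of a quadratic.  For κ = c and θ = -1
-- these roots are c(μ + η ± √((μ+η)² - 4η))/2; for κ = c and θ = η - 1 they are 0
-- and cμ.  The smaller root of the former pair is at most c, and every eigenvalue
-- other than it and 0 is at least c.  The discriminants are positive, so all square
-- roots are invertible and the eigenvectors form a basis constructively.

module Submission where

open import Algebra.Bundles using (CommutativeRing)
import Algebra.Properties.Ring as RingProperties
import Algebra.Properties.Semiring.Sum as SemiringSum
import Algebra.Solver.Ring as RingSolver
open import Algebra.Solver.Ring.AlmostCommutativeRing
  using (fromCommutativeRing; _-Raw-AlmostCommutative⟶_; -raw-almostCommutative⟶)
open import Data.Bool.Base using (true; false; if_then_else_; _∧_; _∨_; not; Bool)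
open import Data.Fin.Base using (Fin; zero; suc; toℕ; combine; remQuot; _↑ˡ_; _↑ʳ_)
import Data.Fin.Properties as Fin
open import Data.Integer.Base using (+_)
import Data.Maybe.Base as Maybe
open import Data.Nat.Base as ℕ using (ℕ; zero; suc) renaming (_≤_ to _≤ℕ_)
import Data.Nat.Properties as ℕ
open import Data.Product.Base using (_×_; _,_; ∃; proj₁; proj₂; uncurry)
open import Data.Rational.Base as ℚ using (ℚ; 0ℚ; 1ℚ; ½)
import Data.Rational.Properties as ℚ
open import Data.Sum.Base using (_⊎_; inj₁; inj₂)
import Data.Vec.Base as Vec
open import Data.Vec.Functional using (Vector)
open import Function.Base using (_∘_)
open import Level using (0ℓ)
import Relation.Binary.PropositionalEquality as ≡
open ≡ using (_≡_)
import Relation.Binary.Reasoning.Setoid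
open import Relation.Nullary using (does; yes; no; ¬_; contradiction)
open import Relation.Nullary.Decidable using (dec⇒maybe)
open import Relation.Unary using (Pred; Decidable)
open import Defs using (Graph; W′; K; _×ᴷ_; mesh-suc)

-- The algebra is done over an arbitrary commutative ring with a homomorphism from ℚ, because it is
-- used twice. Over ℝ it gives the basis and the eigenvector equations. Over ℚ it gives the
-- inequalities between discriminants and their bounds, where case distinctions on the order are
-- available. The passage from ℚ to ℝ is cheap: every radicand is rational, and a real expression in
-- natural constants is a constant sequence that evaluates to its rational counterpart.
-- Nonnegativity is turned into identities. Once `c`, `N` and `h` are measured from their least
-- values 1, 2 and 2, each rational quantity to be bounded is a polynomial with natural
-- coefficients. The bases are explicit but not orthogonal. Independence and spanning therefore come
-- from inverting a few scalars: the number of vertices of a complete graph, `κ`, and the roots of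
-- the discriminants.

module LinearAlgebra
  (R : CommutativeRing 0ℓ 0ℓ)
  (φ : ℚ.+-*-rawRing -Raw-AlmostCommutative⟶ fromCommutativeRing R)
  where

  open CommutativeRing R hiding (zero)
  open _-Raw-AlmostCommutative⟶_ φ
  open SemiringSum semiring
  open RingProperties ring using (-0#≈0#)
  open Relation.Binary.Reasoning.Setoid setoid

  ⟦⟧-≟ : ∀ p q → Maybe.Maybe (⟦ p ⟧ ≈ ⟦ q ⟧)
  ⟦⟧-≟ p q = Maybe.map (λ p≡q → reflexive (≡.cong ⟦_⟧ p≡q)) (dec⇒maybe (p ℚ.≟ q))

  module Solver = RingSolver ℚ.+-*-rawRing (fromCommutativeRing R) φ ⟦⟧-≟
  open Solver using (solve; _:=_; _:+_; _:*_; _:-_; :-_; con)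

  -- Natural scalars, units and finite sums

  ι : ℕ → Carrier
  ι n = ⟦ + n ℚ./ 1 ⟧

  ι-suc : ∀ n → ι (suc n) ≈ ι n + 1#
  ι-suc n = trans (reflexive (≡.cong ⟦_⟧ (≡.sym (mesh-suc n 0))))
    (trans (+-homo _ _) (+-congˡ 1-homo))

  -- Invertibility is carried as data, since over ℝ a refutation of `x ≈ 0#` does not produce an
  -- inverse.
  Unit : Carrier → Set
  Unit x = ∃ λ x⁻¹ → x⁻¹ * x ≈ 1#

  ⟦⟧-unit : ∀ q .{{_ : ℚ.NonZero q}} → Unit ⟦ q ⟧
  ⟦⟧-unit q = ⟦ ℚ.1/ q ⟧ ,
    trans (sym (*-homo _ _)) (trans (reflexive (≡.cong ⟦_⟧ (ℚ.*-inverseˡ q))) 1-homo)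

  ι-unit : ∀ n → Unit (ι (suc n))
  ι-unit n = ⟦⟧-unit q {{ℚ.pos⇒nonZero q {{ℚ.normalize-pos (suc n) 1}}}}
    where
    q : ℚ
    q = + suc n ℚ./ 1

  unit-cancel : ∀ {x y} → Unit x → x * y ≈ 0# → y ≈ 0#
  unit-cancel {x} {y} (x⁻¹ , eq) xy≈0 = begin
    y              ≈⟨ *-identityˡ y ⟨
    1# * y         ≈⟨ *-congʳ eq ⟨
    x⁻¹ * x * y    ≈⟨ *-assoc x⁻¹ x y ⟩
    x⁻¹ * (x * y)  ≈⟨ *-congˡ xy≈0 ⟩
    x⁻¹ * 0#       ≈⟨ zeroʳ x⁻¹ ⟩
    0#             ∎

  -- The inverse is `y⁻¹ * x`. A square root is thus inverted without a sign or a lower bound for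
  -- it, from the inverse of its rational radicand.
  unit-root : ∀ {x y} → x * x ≈ y → Unit y → Unit x
  unit-root {x} x²≈y (y⁻¹ , eq) =
    y⁻¹ * x , trans (*-assoc y⁻¹ x x) (trans (*-congˡ x²≈y) eq)

  unit-resp : ∀ {x y} → x ≈ y → Unit x → Unit y
  unit-resp x≈y (x⁻¹ , eq) = x⁻¹ , trans (*-congˡ (sym x≈y)) eq

  indicator : Bool → Carrier
  indicator b = if b then 1# else 0#

  δ : ∀ {n} → Fin n → Fin n → Carrier
  δ i j = indicator (does (i Fin.≟ j))

  ∑-0 : ∀ {n} {f : Vector Carrier n} → (∀ i → f i ≈ 0#) → sum f ≈ 0#
  ∑-0 {n} f≈0 = trans (sum-cong-≋ f≈0) (sum-replicate-zero n)

  ∑-const : ∀ n x → sum {n} (λ _ → x) ≈ ι n * x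
  ∑-const zero    x = sym (trans (*-congʳ 0-homo) (zeroˡ x))
  ∑-const (suc n) x = begin
    x + sum {n} (λ _ → x)  ≈⟨ +-congˡ (∑-const n x) ⟩
    x + ι n * x            ≈⟨ solve 2 (λ n x → x :+ n :* x := (n :+ con 1ℚ) :* x) refl (ι n) x ⟩
    (ι n + ⟦ 1ℚ ⟧) * x     ≈⟨ *-congʳ (+-congˡ 1-homo) ⟩
    (ι n + 1#) * x         ≈⟨ *-congʳ (ι-suc n) ⟨
    ι (suc n) * x          ∎

  ∑-δʳ : ∀ {n} (f : Vector Carrier n) k → sum (λ i → f i * δ i k) ≈ f k
  ∑-δʳ f zero    = trans (+-cong (*-identityʳ _) (∑-0 λ i → zeroʳ (f (suc i)))) (+-identityʳ _)
  ∑-δʳ f (suc k) = trans (+-cong (zeroʳ _) (∑-δʳ (f ∘ suc) k)) (+-identityˡ _)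

  ∑-δˡ : ∀ {n} (f : Vector Carrier n) k → sum (λ i → δ k i * f i) ≈ f k
  ∑-δˡ f zero    = trans (+-cong (*-identityˡ _) (∑-0 λ i → zeroˡ (f (suc i)))) (+-identityʳ _)
  ∑-δˡ f (suc k) = trans (+-cong (zeroˡ _) (∑-δˡ (f ∘ suc) k)) (+-identityˡ _)

  ∑-distrib-- : ∀ {n} (f g : Vector Carrier n) → sum (λ i → f i - g i) ≈ sum f - sum g
  ∑-distrib-- {zero}  f g = sym (trans (+-identityˡ _) -0#≈0#)
  ∑-distrib-- {suc n} f g = trans (+-congˡ (∑-distrib-- (f ∘ suc) (g ∘ suc)))
    (solve 4 (λ a b c d → (a :- b) :+ (c :- d) := (a :+ c) :- (b :+ d)) refl _ _ _ _)

  ∑-↑ : ∀ n {k} (f : Vector Carrier (n ℕ.+ k)) →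
    sum f ≈ sum (λ i → f (i ↑ˡ k)) + sum (λ j → f (n ↑ʳ j))
  ∑-↑ zero    f = sym (+-identityˡ _)
  ∑-↑ (suc n) f = trans (+-congˡ (∑-↑ n (f ∘ suc))) (sym (+-assoc _ _ _))

  ∑-combine : ∀ n {k} (f : Vector Carrier (n ℕ.* k)) →
    sum f ≈ sum λ (i : Fin n) → sum λ j → f (combine i j)
  ∑-combine zero        f = refl
  ∑-combine (suc n) {k} f = trans (∑-↑ k f) (+-congˡ (∑-combine n (λ s → f (k ↑ʳ s))))

  ∑-remQuot : ∀ n {k} (f : Fin n → Fin k → Carrier) →
    sum (λ s → uncurry f (remQuot {n} k s)) ≈ sum λ i → sum λ j → f i j
  ∑-remQuot n {k} f = trans (∑-combine n {k} _) (sum-cong-≋ λ i → sum-cong-≋ λ j →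
    reflexive (≡.cong (uncurry f) (Fin.remQuot-combine i j)))

  -- Bases with explicit coordinates

  combination : ∀ {n} → Vector Carrier n → (Fin n → Vector Carrier n) → Vector Carrier n
  combination c b k = sum λ i → c i * b i k

  record Basis {n} (b : Fin n → Vector Carrier n) : Set where
    field
      independent : ∀ (c : Vector Carrier n) → (∀ k → combination c b k ≈ 0#) → ∀ i → c i ≈ 0#
      spanning    : ∀ (v : Vector Carrier n) → ∃ λ (c : Vector Carrier n) → ∀ k → v k ≈ combination c b k

  open Basis

  -- An eigenbasis of the complete graph with entries 0, 1 and -1: the all-ones vector and the
  -- vectors e_{i+1} - e_0, which are eigenvectors because their entries sum to 0.
  differences : ∀ {n} → Fin (suc n) → Vector Carrier (suc n)
  differences zero    _       = 1#
  differences (suc i) zero    = - 1#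
  differences (suc i) (suc k) = δ i k

  combination-differences-zero : ∀ {n} (c : Vector Carrier (suc n)) →
    combination c differences zero ≈ c zero - sum (c ∘ suc)
  combination-differences-zero c = begin
    c zero * 1# + sum (λ i → c (suc i) * - 1#)  ≈⟨ +-congˡ (*-distribʳ-sum (- 1#) (c ∘ suc)) ⟨
    c zero * 1# + sum (c ∘ suc) * - 1#
      ≈⟨ +-cong (*-identityʳ _) (trans (sym (-‿distribʳ-* _ _)) (-‿cong (*-identityʳ _))) ⟩
    c zero - sum (c ∘ suc)                      ∎
    where open RingProperties ring using (-‿distribʳ-*)

  combination-differences-suc : ∀ {n} (c : Vector Carrier (suc n)) k →
    combination c differences (suc k) ≈ c zero + c (suc k)
  combination-differences-suc c k = +-cong (*-identityʳ _) (∑-δʳ (c ∘ suc) k)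

  ∑-differences : ∀ {n} i → sum (differences {n} (suc i)) ≈ 0#
  ∑-differences i = begin
    - 1# + sum (δ i)                 ≈⟨ +-congˡ (sum-cong-≋ λ k → *-identityʳ (δ i k)) ⟨
    - 1# + sum (λ k → δ i k * 1#)    ≈⟨ +-congˡ (∑-δˡ (λ _ → 1#) i) ⟩
    - 1# + 1#                        ≈⟨ -‿inverseˡ 1# ⟩
    0#                               ∎

  -- The coefficient of the all-ones vector is the mean of the coordinates.
  differences-basis : ∀ n → Basis (differences {n})
  differences-basis n .independent c h = λ where
      zero    → c₀≈0
      (suc k) → trans (c₊≈-c₀ k) (trans (-‿cong c₀≈0) -0#≈0#)
    where
    c₊≈-c₀ : ∀ k → c (suc k) ≈ - c zero
    c₊≈-c₀ k = begin
      c (suc k)                      ≈⟨ solve 2 (λ x y → y := (x :+ y) :- x) refl (c zero) _ ⟩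
      c zero + c (suc k) - c zero    ≈⟨ +-congʳ (combination-differences-suc c k) ⟨
      combination c differences (suc k) - c zero ≈⟨ +-congʳ (h (suc k)) ⟩
      0# - c zero                    ≈⟨ +-identityˡ _ ⟩
      - c zero                       ∎
    c₀≈0 : c zero ≈ 0#
    c₀≈0 = unit-cancel (ι-unit n) (begin
      ι (suc n) * c zero          ≈⟨ *-congʳ (trans (ι-suc n) (+-congˡ (sym 1-homo))) ⟩
      (ι n + ⟦ 1ℚ ⟧) * c zero
        ≈⟨ solve 2 (λ n x → (n :+ con 1ℚ) :* x := x :- n :* :- x) refl (ι n) (c zero) ⟩
      c zero - ι n * - c zero     ≈⟨ +-congˡ (-‿cong (∑-const n _)) ⟨
      c zero - sum {n} (λ _ → - c zero) ≈⟨ +-congˡ (-‿cong (sum-cong-≋ c₊≈-c₀)) ⟨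
      c zero - sum (c ∘ suc)      ≈⟨ combination-differences-zero c ⟨
      combination c differences zero ≈⟨ h zero ⟩
      0#                          ∎)
  differences-basis n .spanning v = c , λ where
      zero    → begin
        v zero
          ≈⟨ solve 2 (λ v t → v := (v :+ t) :- t) refl (v zero) (sum (v ∘ suc)) ⟩
        sum v - sum (v ∘ suc)                        ≈⟨ +-congʳ nmean ⟨
        ι (suc n) * mean - sum (v ∘ suc)
          ≈⟨ +-congʳ (*-congʳ (trans (ι-suc n) (+-congˡ (sym 1-homo)))) ⟩
        (ι n + ⟦ 1ℚ ⟧) * mean - sum (v ∘ suc)
          ≈⟨ solve 3 (λ n m t → (n :+ con 1ℚ) :* m :- t := m :- (t :- n :* m)) refl (ι n) mean _ ⟩
        mean - (sum (v ∘ suc) - ι n * mean)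
          ≈⟨ +-congˡ (-‿cong (+-congˡ (-‿cong (∑-const n mean)))) ⟨
        mean - (sum (v ∘ suc) - sum {n} (λ _ → mean))
          ≈⟨ +-congˡ (-‿cong (∑-distrib-- (v ∘ suc) (λ _ → mean))) ⟨
        mean - sum (c ∘ suc)                         ≈⟨ combination-differences-zero c ⟨
        combination c differences zero               ∎
      (suc k) → begin
        v (suc k)                          ≈⟨ solve 2 (λ v m → v := m :+ (v :- m)) refl _ mean ⟩
        mean + (v (suc k) - mean)          ≈⟨ combination-differences-suc c k ⟨
        combination c differences (suc k)  ∎
    where
    mean : Carrier
    mean = proj₁ (ι-unit n) * sum v
    nmean : ι (suc n) * mean ≈ sum v
    nmean = begin
      ι (suc n) * (proj₁ (ι-unit n) * sum v)
        ≈⟨ solve 3 (λ x y z → x :* (y :* z) := y :* x :* z) refl _ _ _ ⟩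
      proj₁ (ι-unit n) * ι (suc n) * sum v  ≈⟨ *-congʳ (proj₂ (ι-unit n)) ⟩
      1# * sum v                            ≈⟨ *-identityˡ _ ⟩
      sum v                                 ∎
    c : Vector Carrier (suc n)
    c zero    = mean
    c (suc k) = v (suc k) - mean

  rooted : ∀ {n} → (p₁ p₂ q : Carrier) → Fin (suc (suc n)) → Vector Carrier (suc (suc n))
  rooted p₁ p₂ q zero          zero    = p₁
  rooted p₁ p₂ q (suc zero)    zero    = p₂
  rooted p₁ p₂ q (suc (suc i)) zero    = 0#
  rooted p₁ p₂ q zero          (suc k) = q
  rooted p₁ p₂ q (suc zero)    (suc k) = q
  rooted p₁ p₂ q (suc (suc i)) (suc k) = differences (suc i) k

  module _ {n : ℕ} (p₁ p₂ q : Carrier) (p₁-p₂-unit : Unit (p₁ - p₂)) (q-unit : Unit q) where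

    private
      -- The coefficients with respect to differences of the part of the
      -- combination away from the root.
      tailCoefficients : Vector Carrier (suc (suc n)) → Vector Carrier (suc n)
      tailCoefficients c zero    = (c zero + c (suc zero)) * q
      tailCoefficients c (suc i) = c (suc (suc i))

      at-zero : ∀ c → combination c (rooted {n} p₁ p₂ q) zero ≈ c zero * p₁ + c (suc zero) * p₂
      at-zero c = +-congˡ (trans (+-congˡ (∑-0 λ i → zeroʳ (c (suc (suc i))))) (+-identityʳ _))

      at-suc : ∀ c k → combination c (rooted p₁ p₂ q) (suc k) ≈
                       combination (tailCoefficients c) differences k
      at-suc c k = trans (sym (+-assoc _ _ _))
        (+-congʳ (trans (sym (distribʳ q _ _)) (sym (*-identityʳ _))))

    -- Away from the root the first two vectors are both `q` times the all-ones vector, so the basis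
    -- `differences` determines the sum of their coefficients once `q` is inverted. The value at the
    -- root then separates the two, with determinant `p₁ - p₂`.
    rooted-basis : Basis (rooted {n} p₁ p₂ q)
    rooted-basis .independent c h = λ where
        zero          → c₀≈0
        (suc zero)    → begin
          c (suc zero)                    ≈⟨ solve 2 (λ x y → y := (x :+ y) :- x) refl (c zero) _ ⟩
          c zero + c (suc zero) - c zero  ≈⟨ +-cong c₀+c₁≈0 (-‿cong c₀≈0) ⟩
          0# - 0#                         ≈⟨ -‿inverseʳ 0# ⟩
          0#                              ∎
        (suc (suc i)) → tail≈0 (suc i)
      where
      tail≈0 : ∀ i → tailCoefficients c i ≈ 0#
      tail≈0 = differences-basis n .independent (tailCoefficients c)
        (λ k → trans (sym (at-suc c k)) (h (suc k)))
      c₀+c₁≈0 : c zero + c (suc zero) ≈ 0#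
      c₀+c₁≈0 = unit-cancel q-unit (trans (*-comm q _) (tail≈0 zero))
      c₀≈0 : c zero ≈ 0#
      c₀≈0 = unit-cancel p₁-p₂-unit (begin
        (p₁ - p₂) * c zero
          ≈⟨ solve 4 (λ p₁ p₂ c₀ c₁ → (p₁ :- p₂) :* c₀ :=
               (c₀ :* p₁ :+ c₁ :* p₂) :- p₂ :* (c₀ :+ c₁)) refl p₁ p₂ (c zero) (c (suc zero)) ⟩
        (c zero * p₁ + c (suc zero) * p₂) - p₂ * (c zero + c (suc zero))
          ≈⟨ +-cong (trans (sym (at-zero c)) (h zero)) (-‿cong (trans (*-congˡ c₀+c₁≈0) (zeroʳ p₂))) ⟩
        0# - 0#  ≈⟨ -‿inverseʳ 0# ⟩
        0#       ∎)
    rooted-basis .spanning v = c , λ where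
        zero    → sym (begin
          combination c (rooted p₁ p₂ q) zero    ≈⟨ at-zero c ⟩
          c₀ * p₁ + (t - c₀) * p₂
            ≈⟨ solve 5 (λ g p₁ p₂ v t →
                 (g :* (v :- t :* p₂)) :* p₁ :+ (t :- g :* (v :- t :* p₂)) :* p₂ :=
                 g :* (p₁ :- p₂) :* (v :- t :* p₂) :+ t :* p₂)
                 refl (proj₁ p₁-p₂-unit) p₁ p₂ (v zero) t ⟩
          proj₁ p₁-p₂-unit * (p₁ - p₂) * (v zero - t * p₂) + t * p₂
            ≈⟨ +-congʳ (trans (*-congʳ (proj₂ p₁-p₂-unit)) (*-identityˡ _)) ⟩
          v zero - t * p₂ + t * p₂
            ≈⟨ solve 2 (λ v x → (v :- x) :+ x := v) refl (v zero) (t * p₂) ⟩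
          v zero                                 ∎)
        (suc k) → begin
          v (suc k)                               ≈⟨ proj₂ tail k ⟩
          combination (proj₁ tail) differences k  ≈⟨ sum-cong-≋ {suc n} (λ i → *-congʳ {differences i k} (tail≈ i)) ⟨
          combination (tailCoefficients c) differences k ≈⟨ at-suc c k ⟨
          combination c (rooted p₁ p₂ q) (suc k)  ∎
      where
      tail : ∃ λ e → ∀ k → v (suc k) ≈ combination e differences k
      tail = differences-basis n .spanning (v ∘ suc)
      -- `t` is the sum that the first two coefficients must have; `c₀` solves
      -- `c₀ * p₁ + (t - c₀) * p₂ ≈ v zero`.
      t : Carrier
      t = proj₁ q-unit * proj₁ tail zero
      c₀ : Carrier
      c₀ = proj₁ p₁-p₂-unit * (v zero - t * p₂)
      c : Vector Carrier (suc (suc n))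
      c zero          = c₀
      c (suc zero)    = t - c₀
      c (suc (suc i)) = proj₁ tail (suc i)
      tail≈ : ∀ i → tailCoefficients c i ≈ proj₁ tail i
      tail≈ (suc i) = refl
      tail≈ zero    = begin
        (c₀ + (t - c₀)) * q
          ≈⟨ solve 4 (λ c y e q → (c :+ (y :* e :- c)) :* q := y :* q :* e)
               refl c₀ (proj₁ q-unit) (proj₁ tail zero) q ⟩
        proj₁ q-unit * q * proj₁ tail zero  ≈⟨ *-congʳ (proj₂ q-unit) ⟩
        1# * proj₁ tail zero                ≈⟨ *-identityˡ _ ⟩
        proj₁ tail zero                     ∎

  -- Bases of tensor products

  record Pairing (N n k : ℕ) : Set where
    field
      decode₁       : Fin N → Fin n
      decode₂       : Fin N → Fin k
      encode        : Fin n → Fin k → Fin N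
      decode₁-encode : ∀ i j → decode₁ (encode i j) ≡ i
      decode₂-encode : ∀ i j → decode₂ (encode i j) ≡ j
      encode-decode : ∀ s → encode (decode₁ s) (decode₂ s) ≡ s
      ∑-encode      : ∀ (f : Vector Carrier N) → sum f ≈ sum λ i → sum λ j → f (encode i j)

  remQuot-pairing : ∀ n k → Pairing (n ℕ.* k) n k
  remQuot-pairing n k = record
    { decode₁ = λ s → proj₁ (remQuot {n} k s)
    ; decode₂ = λ s → proj₂ (remQuot {n} k s)
    ; encode = combine
    ; decode₁-encode = λ i j → ≡.cong proj₁ (Fin.remQuot-combine {n} i j)
    ; decode₂-encode = λ i j → ≡.cong proj₂ (Fin.remQuot-combine {n} i j)
    ; encode-decode = Fin.combine-remQuot {n} k
    ; ∑-encode = ∑-combine n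
    }

  swap-pairing : ∀ {N n k} → Pairing N n k → Pairing N k n
  swap-pairing P = record
    { decode₁ = P.decode₂
    ; decode₂ = P.decode₁
    ; encode = λ j i → P.encode i j
    ; decode₁-encode = λ j i → P.decode₂-encode i j
    ; decode₂-encode = λ j i → P.decode₁-encode i j
    ; encode-decode = P.encode-decode
    ; ∑-encode = λ f → trans (P.∑-encode f) (∑-comm (λ i j → f (P.encode i j)))
    }
    where module P = Pairing P

  module _ {N n k : ℕ} (P : Pairing N n k) where

    open Pairing P

    -- The basis of the second factor may vary with the index in the first. This is more than a
    -- Kronecker product of two bases, and the profiles, which vary with `θ` and `κ`, require it.
    tensor : (Fin n → Vector Carrier n) → (Fin n → Fin k → Vector Carrier k) →
             Fin N → Vector Carrier N
    tensor x z s t = x (decode₁ s) (decode₁ t) * z (decode₁ s) (decode₂ s) (decode₂ t)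

    combination-tensor : ∀ x z c t → combination c (tensor x z) t ≈
      combination (λ i → combination (λ j → c (encode i j)) (z i) (decode₂ t)) x (decode₁ t)
    combination-tensor x z c t = begin
      combination c (tensor x z) t
        ≈⟨ ∑-encode (λ s → c s * tensor x z s t) ⟩
      (sum λ i → sum λ j → c (encode i j) * tensor x z (encode i j) t)
        ≈⟨ sum-cong-≋ (λ i → sum-cong-≋ λ j → *-congˡ {c (encode i j)} (reflexive
             (≡.cong₂ (λ i′ j′ → x i′ (decode₁ t) * z i′ j′ (decode₂ t))
               (decode₁-encode i j) (decode₂-encode i j)))) ⟩
      (sum λ i → sum λ j → c (encode i j) * (x i (decode₁ t) * z i j (decode₂ t)))
        ≈⟨ sum-cong-≋ (λ i → sum-cong-≋ λ j →
             solve 3 (λ c x z → c :* (x :* z) := c :* z :* x) refl (c (encode i j)) _ _) ⟩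
      (sum λ i → sum λ j → c (encode i j) * z i j (decode₂ t) * x i (decode₁ t))
        ≈⟨ sum-cong-≋ (λ i → *-distribʳ-sum (x i (decode₁ t)) (λ j → c (encode i j) * z i j (decode₂ t))) ⟨
      combination (λ i → combination (λ j → c (encode i j)) (z i) (decode₂ t)) x (decode₁ t) ∎

    -- Each slice with fixed second coordinate is a combination of `x`; its i-th coefficient, as a
    -- function of that coordinate, is a combination of `z i`. Independence and spanning both follow
    -- by using first `x` and then `z i`.
    tensor-basis : ∀ {x z} → Basis x → (∀ i → Basis (z i)) → Basis (tensor x z)
    tensor-basis {x} {z} bx bz .independent c h s = trans
      (reflexive (≡.cong c (≡.sym (encode-decode s))))
      (bz (decode₁ s) .independent (λ j → c (encode (decode₁ s) j))
        (λ j′ → bx .independent (λ i → combination (λ j → c (encode i j)) (z i) j′)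
          (λ i′ → trans
            (reflexive (≡.cong₂ (λ a b → combination (λ i → combination (λ j → c (encode i j)) (z i) a) x b)
              (≡.sym (decode₂-encode i′ j′)) (≡.sym (decode₁-encode i′ j′))))
            (trans (sym (combination-tensor x z c (encode i′ j′))) (h (encode i′ j′))))
          (decode₁ s))
        (decode₂ s))
    tensor-basis {x} {z} bx bz .spanning v = c , λ t → begin
        v t
          ≈⟨ reflexive (≡.cong v (≡.sym (encode-decode t))) ⟩
        v (encode (decode₁ t) (decode₂ t))
          ≈⟨ proj₂ (w (decode₂ t)) (decode₁ t) ⟩
        combination (proj₁ (w (decode₂ t))) x (decode₁ t)
          ≈⟨ sum-cong-≋ (λ i → *-congʳ (trans (proj₂ (e i) (decode₂ t))
               (sum-cong-≋ λ j → *-congʳ (reflexive (≡.cong₂ (λ i′ j′ → proj₁ (e i′) j′)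
                 (≡.sym (decode₁-encode i j)) (≡.sym (decode₂-encode i j))))))) ⟩
        combination (λ i → combination (λ j → c (encode i j)) (z i) (decode₂ t)) x (decode₁ t)
          ≈⟨ combination-tensor x z c t ⟨
        combination c (tensor x z) t ∎
      where
      w : ∀ j′ → ∃ λ d → ∀ i′ → v (encode i′ j′) ≈ combination d x i′
      w j′ = bx .spanning (λ i′ → v (encode i′ j′))
      e : ∀ i → ∃ λ d → ∀ j′ → proj₁ (w j′) i ≈ combination d (z i) j′
      e i = bz i .spanning (λ j′ → proj₁ (w j′) i)
      c : Vector Carrier N
      c s = proj₁ (e (decode₁ s)) (decode₂ s)

  -- Laplacians

  indicator-if : ∀ b {x} → (if b then x else 0#) ≈ indicator b * x
  indicator-if true  = sym (*-identityˡ _)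
  indicator-if false = sym (zeroˡ _)

  ι-count : ∀ {n} {A : Set} {P : Pred A 0ℓ} (P? : Decidable P) (f : Fin n → A) →
    ι (Vec.count P? (Vec.tabulate f)) ≈ sum (λ i → indicator (does (P? (f i))))
  ι-count {zero}  P? f = 0-homo
  ι-count {suc n} P? f with does (P? (f zero))
  ... | true  = trans (ι-suc (Vec.count P? (Vec.tabulate (f ∘ suc))))
    (trans (+-comm _ 1#) (+-congˡ (ι-count P? (f ∘ suc))))
  ... | false = trans (ι-count P? (f ∘ suc)) (sym (+-identityˡ _))

  module _ (G : Graph) where

    open Graph G

    adjacency laplacian : Fin order → Vector Carrier order
    adjacency i j = indicator (does (adj? (vertex i) (vertex j)))
    laplacian i j =
      (if does (i Fin.≟ j) then ι (degree (vertex i)) else 0#) - adjacency i j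

    -- The degree is a row sum of the adjacency matrix, so the Laplacian is known as soon as the
    -- action of the adjacency matrix is.
    laplacian-action : ∀ i v → sum (λ j → laplacian i j * v j) ≈
      sum (adjacency i) * v i - sum (λ j → adjacency i j * v j)
    laplacian-action i v = begin
      sum (λ j → laplacian i j * v j)
        ≈⟨ sum-cong-≋ (λ j → trans (*-congʳ (+-congʳ (indicator-if (does (i Fin.≟ j)))))
             (solve 4 (λ e d a x → (e :* d :- a) :* x := d :* (e :* x) :- a :* x) refl
               (δ i j) (ι (degree (vertex i))) (adjacency i j) (v j))) ⟩
      sum (λ j → ι (degree (vertex i)) * (δ i j * v j) - adjacency i j * v j)
        ≈⟨ ∑-distrib-- (λ j → ι (degree (vertex i)) * (δ i j * v j)) (λ j → adjacency i j * v j) ⟩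
      sum (λ j → ι (degree (vertex i)) * (δ i j * v j)) - sum (λ j → adjacency i j * v j)
        ≈⟨ +-congʳ (*-distribˡ-sum (ι (degree (vertex i))) (λ j → δ i j * v j)) ⟨
      ι (degree (vertex i)) * sum (λ j → δ i j * v j) - sum (λ j → adjacency i j * v j)
        ≈⟨ +-congʳ (*-cong (ι-count (adj? (vertex i)) vertex) (∑-δˡ v i)) ⟩
      sum (adjacency i) * v i - sum (λ j → adjacency i j * v j) ∎

  ∑-off-diagonal : ∀ {n} (y : Vector Carrier n) k →
    sum (λ l → (1# - δ k l) * y l) ≈ sum y - y k
  ∑-off-diagonal y k = begin
    sum (λ l → (1# - δ k l) * y l)
      ≈⟨ sum-cong-≋ (λ l → trans (distribʳ (y l) 1# _)
           (+-cong (*-identityˡ _) (sym (-‿distribˡ-* _ _)))) ⟩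
    sum (λ l → y l - δ k l * y l)        ≈⟨ ∑-distrib-- y (λ l → δ k l * y l) ⟩
    sum y - sum (λ l → δ k l * y l)      ≈⟨ +-congˡ (-‿cong (∑-δˡ y k)) ⟩
    sum y - y k                          ∎
    where open RingProperties ring using (-‿distribˡ-*)

  -- Adjacency of the product graph

  atRoot : ∀ {n} → Fin n → Carrier
  atRoot a = indicator (does (toℕ a ℕ.≟ 0))

  ∑-atRoot : ∀ {n} (w : Vector Carrier (suc n)) → sum (λ b → atRoot b * w b) ≈ w zero
  ∑-atRoot w = trans (+-cong (*-identityˡ _) (∑-0 λ b → zeroˡ (w (suc b)))) (+-identityʳ _)

  -- The left side is the Boolean to which the adjacency decision of the product evaluates. The two
  -- kinds of edges exclude each other through `p` and `not p`, so the disjunction becomes a plain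
  -- sum.
  indicator-edge : ∀ p q r s t →
    indicator (((p ∧ not q) ∨ (not p ∧ (r ∧ s))) ∧ not t) ≈
    (indicator p * (1# - indicator q) + (1# - indicator p) * (indicator r * indicator s))
      * (1# - indicator t)
  indicator-edge p q r s t = trans (and _ (not t)) (*-cong
    (trans (or p) (+-cong
      (trans (and p (not q)) (*-congˡ (neg q)))
      (trans (and (not p) (r ∧ s)) (*-cong (neg p) (and r s)))))
    (neg t))
    where
    and : ∀ x y → indicator (x ∧ y) ≈ indicator x * indicator y
    and true  y = sym (*-identityˡ _)
    and false y = sym (zeroˡ _)
    neg : ∀ x → indicator (not x) ≈ 1# - indicator x
    neg true  = sym (-‿inverseʳ 1#)
    neg false = sym (trans (+-congˡ -0#≈0#) (+-identityʳ 1#))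
    or : ∀ x {y z} → indicator ((x ∧ y) ∨ (not x ∧ z)) ≈
                     indicator (x ∧ y) + indicator (not x ∧ z)
    or true  {true}  = sym (+-identityʳ _)
    or true  {false} = sym (+-identityʳ _)
    or false         = sym (+-identityˡ _)

  module _ {η n m : ℕ} where

    private
      μ : ℕ
      μ = suc n
      W×K : Graph
      W×K = W′ η μ ×ᴷ K m

    hub : Fin (η ℕ.* μ ℕ.* m) → Fin η
    hub s = proj₁ (remQuot {η} μ (proj₁ (remQuot {η ℕ.* μ} m s)))

    spoke : Fin (η ℕ.* μ ℕ.* m) → Fin μ
    spoke s = proj₂ (remQuot {η} μ (proj₁ (remQuot {η ℕ.* μ} m s)))

    layer : Fin (η ℕ.* μ ℕ.* m) → Fin m
    layer s = proj₂ (remQuot {η ℕ.* μ} m s)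

    ∑-vertices : ∀ (f : Fin η → Fin μ → Fin m → Carrier) →
      sum (λ t → f (hub t) (spoke t) (layer t)) ≈ sum λ v → sum λ b → sum λ l → f v b l
    ∑-vertices f = trans
      (∑-remQuot (η ℕ.* μ) {m} (λ p l → f (proj₁ (remQuot μ p)) (proj₂ (remQuot {η} μ p)) l))
      (∑-remQuot η {μ} (λ v b → sum λ l → f v b l))

    -- The hypotheses say that `x` and `y` are eigenvectors of J - I; `w` is arbitrary. Summing over
    -- layers gives the factor `κ`. Edges inside a copy keep `x` and apply J - I to `w`; edges
    -- between copies turn `x` into `θ x` and see only the value of `w` at the root.
    adjacency-action : ∀ {x : Vector Carrier η} {y : Vector Carrier m} {θ κ} →
      (∀ u → sum x - x u ≈ θ * x u) → (∀ k → sum y - y k ≈ κ * y k) →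
      ∀ (w : Vector Carrier μ) s →
      sum (λ t → adjacency W×K s t * (y (layer t) * (x (hub t) * w (spoke t)))) ≈
      κ * (y (layer s) * (x (hub s) *
        ((sum w - w (spoke s)) + θ * (atRoot (spoke s) * w zero))))
    adjacency-action {x} {y} {θ} {κ} hx hy w s = begin
      sum (λ t → adjacency W×K s t * (y (layer t) * (x (hub t) * w (spoke t))))
        ≈⟨ sum-cong-≋ (λ t → *-congʳ {y (layer t) * (x (hub t) * w (spoke t))}
             (indicator-edge (does (u Fin.≟ hub t)) (does (a Fin.≟ spoke t))
             (does (toℕ a ℕ.≟ 0)) (does (toℕ (spoke t) ℕ.≟ 0)) (does (k Fin.≟ layer t)))) ⟩
      sum (λ t → edge (hub t) (spoke t) * (1# - δ k (layer t))
                   * (y (layer t) * (x (hub t) * w (spoke t))))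
        ≈⟨ ∑-vertices (λ v b l → edge v b * (1# - δ k l) * (y l * (x v * w b))) ⟩
      (sum λ v → sum λ b → sum λ l → edge v b * (1# - δ k l) * (y l * (x v * w b)))
        ≈⟨ sum-cong-≋ (λ v → sum-cong-≋ (∑-layers v)) ⟩
      (sum λ v → sum λ b → edge v b * (x v * w b) * Y)
        ≈⟨ sum-cong-≋ ∑-spokes ⟩
      (sum λ v → δ u v * x v * (Y * (sum w - w a)) + (1# - δ u v) * x v * (r * Y * w zero))
        ≈⟨ ∑-distrib-+ (λ v → δ u v * x v * (Y * (sum w - w a)))
                       (λ v → (1# - δ u v) * x v * (r * Y * w zero)) ⟩
      sum (λ v → δ u v * x v * (Y * (sum w - w a)))
        + sum (λ v → (1# - δ u v) * x v * (r * Y * w zero))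
        ≈⟨ +-cong (*-distribʳ-sum _ (λ v → δ u v * x v)) (*-distribʳ-sum _ (λ v → (1# - δ u v) * x v)) ⟨
      sum (λ v → δ u v * x v) * (Y * (sum w - w a))
        + sum (λ v → (1# - δ u v) * x v) * (r * Y * w zero)
        ≈⟨ +-cong (*-congʳ (∑-δˡ x u)) (*-congʳ (trans (∑-off-diagonal x u) (hx u))) ⟩
      x u * (Y * (sum w - w a)) + θ * x u * (r * Y * w zero)
        ≈⟨ solve 7 (λ κ y x d θ r w₀ →
             x :* (κ :* y :* d) :+ θ :* x :* (r :* (κ :* y) :* w₀) :=
             κ :* (y :* (x :* (d :+ θ :* (r :* w₀))))) refl
             κ (y k) (x u) (sum w - w a) θ r (w zero) ⟩
      κ * (y k * (x u * ((sum w - w a) + θ * (r * w zero)))) ∎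
      where
      u : Fin η
      u = hub s
      a : Fin μ
      a = spoke s
      k : Fin m
      k = layer s
      r Y : Carrier
      r = atRoot a
      Y = κ * y k
      edge : Fin η → Fin μ → Carrier
      edge v b = δ u v * (1# - δ a b) + (1# - δ u v) * (r * atRoot b)
      ∑-layers : ∀ v b → sum (λ l → edge v b * (1# - δ k l) * (y l * (x v * w b))) ≈
                         edge v b * (x v * w b) * Y
      ∑-layers v b = begin
        sum (λ l → edge v b * (1# - δ k l) * (y l * (x v * w b)))
          ≈⟨ sum-cong-≋ (λ l → solve 4 (λ e d y z → e :* d :* (y :* z) := e :* z :* (d :* y)) refl
               (edge v b) (1# - δ k l) (y l) (x v * w b)) ⟩
        sum (λ l → edge v b * (x v * w b) * ((1# - δ k l) * y l))
          ≈⟨ *-distribˡ-sum (edge v b * (x v * w b)) (λ l → (1# - δ k l) * y l) ⟨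
        edge v b * (x v * w b) * sum (λ l → (1# - δ k l) * y l)
          ≈⟨ *-congˡ (trans (∑-off-diagonal y k) (hy k)) ⟩
        edge v b * (x v * w b) * Y ∎
      ∑-spokes : ∀ v → sum (λ b → edge v b * (x v * w b) * Y) ≈
        δ u v * x v * (Y * (sum w - w a)) + (1# - δ u v) * x v * (r * Y * w zero)
      ∑-spokes v = begin
        sum (λ b → edge v b * (x v * w b) * Y)
          ≈⟨ sum-cong-≋ (λ b → solve 8 (λ d d′ e r s x w Y →
               (d :* e :+ d′ :* (r :* s)) :* (x :* w) :* Y :=
               d :* x :* Y :* (e :* w) :+ d′ :* x :* (r :* Y) :* (s :* w)) refl
               (δ u v) (1# - δ u v) (1# - δ a b) r (atRoot b) (x v) (w b) Y) ⟩
        sum (λ b → p * ((1# - δ a b) * w b) + q * (atRoot b * w b))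
          ≈⟨ ∑-distrib-+ (λ b → p * ((1# - δ a b) * w b)) (λ b → q * (atRoot b * w b)) ⟩
        sum (λ b → p * ((1# - δ a b) * w b)) + sum (λ b → q * (atRoot b * w b))
          ≈⟨ +-cong (*-distribˡ-sum p (λ b → (1# - δ a b) * w b))
                    (*-distribˡ-sum q (λ b → atRoot b * w b)) ⟨
        p * sum (λ b → (1# - δ a b) * w b) + q * sum (λ b → atRoot b * w b)
          ≈⟨ +-cong (*-congˡ (∑-off-diagonal w a)) (*-congˡ (∑-atRoot w)) ⟩
        p * (sum w - w a) + q * w zero
          ≈⟨ +-cong (*-assoc _ Y _) (*-assoc _ (r * Y) (w zero)) ⟩
        δ u v * x v * (Y * (sum w - w a)) + (1# - δ u v) * x v * (r * Y * w zero) ∎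
        where
        p q : Carrier
        p = δ u v * x v * Y
        q = (1# - δ u v) * x v * (r * Y)

  -- Eigenvalues of the adjacency matrix J - I. The constant is written `- ⟦ 1ℚ ⟧` so that the ring
  -- solver meets it as the coefficient `:- con 1ℚ`.
  completeEigenvalue : ∀ {n} → Fin (suc n) → Carrier
  completeEigenvalue {n} zero    = ι n
  completeEigenvalue     (suc _) = - ⟦ 1ℚ ⟧

  differences-eigen : ∀ {n} (i k : Fin (suc n)) →
    sum (differences i) - differences i k ≈ completeEigenvalue i * differences i k
  differences-eigen {n} zero k = begin
    1# + sum {n} (λ _ → 1#) - 1#  ≈⟨ solve 2 (λ o s → o :+ s :- o := s) refl 1# _ ⟩
    sum {n} (λ _ → 1#)            ≈⟨ ∑-const n 1# ⟩
    ι n * 1#                      ∎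
  differences-eigen (suc i) k = begin
    sum (differences (suc i)) - differences (suc i) k  ≈⟨ +-congʳ (∑-differences i) ⟩
    0# - differences (suc i) k                         ≈⟨ +-identityˡ _ ⟩
    - differences (suc i) k                            ≈⟨ solve 1 (λ d → :- d := (:- con 1ℚ) :* d) refl _ ⟩
    - ⟦ 1ℚ ⟧ * differences (suc i) k                   ∎

  -- With a single vertex the eigenvalue is 0, hence the two successors. Applied to `κ`, the value
  -- of the first two profiles away from the root, it is where `m` being at least 2 enters the basis
  -- property.
  completeEigenvalue-unit : ∀ {n} (i : Fin (suc (suc n))) → Unit (completeEigenvalue i)
  completeEigenvalue-unit {n} zero = ι-unit n
  completeEigenvalue-unit (suc i)  =
    - ⟦ 1ℚ ⟧ , trans (solve 0 ((:- con 1ℚ) :* (:- con 1ℚ) := con 1ℚ) refl) 1-homo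

  -- A row sum is the adjacency matrix applied to the all-ones vector, which is a product of the
  -- eigenvectors `differences zero` with a constant `w`.
  degree-action : ∀ {η n m} s →
    sum (adjacency (W′ (suc η) (suc n) ×ᴷ K (suc m)) s) ≈
    ι m * (ι n + ι η * atRoot (spoke {suc η} {n} {suc m} s))
  degree-action {η} {n} {m} s = begin
    sum (adjacency G s)
      ≈⟨ sum-cong-≋ (λ t → sym (trans (*-congˡ 1*[1*1]≈1) (*-identityʳ (adjacency G s t)))) ⟩
    sum (λ t → adjacency G s t * (1# * (1# * 1#)))
      ≈⟨ adjacency-action {suc η} {n} {suc m} (differences-eigen {η} zero)
           (differences-eigen {m} zero) (λ _ → 1#) s ⟩
    ι m * (1# * (1# * ((sum {suc n} (λ _ → 1#) - 1#) + ι η * (atRoot a * 1#))))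
      ≈⟨ *-congˡ (trans (*-identityˡ _) (trans (*-identityˡ _) (+-cong
           (trans (differences-eigen {n} zero zero) (*-identityʳ _)) (*-congˡ (*-identityʳ _))))) ⟩
    ι m * (ι n + ι η * atRoot a) ∎
    where
    G : Graph
    G = W′ (suc η) (suc n) ×ᴷ K (suc m)
    a : Fin (suc n)
    a = spoke {suc η} {n} {suc m} s
    1*[1*1]≈1 : 1# * (1# * 1#) ≈ 1#
    1*[1*1]≈1 = trans (*-identityˡ _) (*-identityˡ _)

  -- Eigenvalues and eigenvectors of the product graph

  -- On differences i ⊗ w ⊗ differences k the Laplacian acts on w through the
  -- eigenvalues θ and κ of the two complete graphs.  On the w that are constant
  -- away from the root, this is the matrix [[α, -κ(μ-1)], [-κ, β]].
  -- The arguments are shifted: the graph has suc η hubs, copies of K_μ with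
  -- μ = suc (suc n), and suc (suc m) layers, so h, N and c are those sizes minus 1.
  module Spectrum (η n m : ℕ) where

    c N h : Carrier
    c = ι (suc m)
    N = ι (suc n)
    h = ι η

    θ : Fin (suc η) → Carrier
    θ = completeEigenvalue

    κ : Fin (suc (suc m)) → Carrier
    κ = completeEigenvalue

    α : Fin (suc η) → Fin (suc (suc m)) → Carrier
    α i k = c * (N + h) - κ k * θ i

    β : Fin (suc (suc m)) → Carrier
    β k = c * N - (N * κ k - κ k)

    discriminant : Fin (suc η) → Fin (suc (suc m)) → Carrier
    discriminant i k = (α i k - β k) * (α i k - β k) + ⟦ + 4 ℚ./ 1 ⟧ * (κ k * κ k * N)

    -- The discriminant is c²(N+1)² at (0 , 0), and c²((N+h)² + 4N) at (suc i , 0);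
    -- r stands for the square root of (N+h)² + 4N = (μ+η)² - 4η, with
    -- the η of the graph, and t for those of the remaining discriminants.
    module Eigenvalues (r : Carrier) (t : Fin (suc η) → Fin (suc m) → Carrier) where

      G : Graph
      G = W′ (suc η) (suc (suc n)) ×ᴷ K (suc (suc m))

      hub′ : Fin (Graph.order G) → Fin (suc η)
      hub′ = hub {suc η} {suc n} {suc (suc m)}

      spoke′ : Fin (Graph.order G) → Fin (suc (suc n))
      spoke′ = spoke {suc η} {suc n} {suc (suc m)}

      layer′ : Fin (Graph.order G) → Fin (suc (suc m))
      layer′ = layer {suc η} {suc n} {suc (suc m)}

      position : Fin (suc η) → Fin (suc (suc n)) → Fin (suc (suc m)) → Fin (Graph.order G)
      position i j k = combine (combine i j) k

      -- Used in contrapositive form: an index other than that of the eigenvalue 0 has a nonzero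
      -- coordinate.
      position-decoded : ∀ {s i j k} → hub′ s ≡ i → spoke′ s ≡ j → layer′ s ≡ k → s ≡ position i j k
      position-decoded {s} ≡.refl ≡.refl ≡.refl = ≡.sym (≡.trans
        (≡.cong (λ p → combine {suc η ℕ.* suc (suc n)} p (layer′ s))
          (Fin.combine-remQuot {suc η} (suc (suc n)) (proj₁ (remQuot {suc η ℕ.* suc (suc n)} (suc (suc m)) s))))
        (Fin.combine-remQuot {suc η ℕ.* suc (suc n)} (suc (suc m)) s))

      -- For `κ = c` the roots are written out: at `zero zero` this makes the lower branch equal to
      -- 0, and at `suc _` it brings in the square root of the claimed formula.
      ρ : Fin (suc η) → Fin (suc (suc m)) → Carrier
      ρ i       (suc k) = t i k
      ρ zero    zero    = c * (N + ⟦ 1ℚ ⟧)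
      ρ (suc _) zero    = c * r

      branch : Fin (suc η) → Fin (suc (suc m)) → Carrier → Carrier
      branch i k r = ⟦ ½ ⟧ * (α i k + β k - r)

      eigenvalue : Fin (suc η) → Fin (suc (suc n)) → Fin (suc (suc m)) → Carrier
      eigenvalue i zero          k = branch i k (ρ i k)
      eigenvalue i (suc zero)    k = branch i k (- ρ i k)
      eigenvalue i (suc (suc _)) k = c * N + κ k

      -- The second row of the matrix makes (β - λ, κ) an eigenvector for λ, and the first row
      -- becomes the characteristic equation. Both branches share the value `κ`, and their root
      -- entries differ by exactly `ρ i k`.
      profile : Fin (suc η) → Fin (suc (suc m)) →
                Fin (suc (suc n)) → Vector Carrier (suc (suc n))
      profile i k = rooted (β k - eigenvalue i zero k) (β k - eigenvalue i (suc zero) k) (κ k)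

      eigenvalues : Vector Carrier (Graph.order G)
      eigenvalues s = eigenvalue (hub′ s) (spoke′ s) (layer′ s)

      eigenvalues-position : ∀ i j k → eigenvalues (position i j k) ≡ eigenvalue i j k
      eigenvalues-position i j k = ≡.trans
        (≡.cong (λ pk → uncurry eigenvalue (remQuot {suc η} (suc (suc n)) (proj₁ pk)) (proj₂ pk))
          (Fin.remQuot-combine {suc η ℕ.* suc (suc n)} (combine i j) k))
        (≡.cong (λ ij → uncurry eigenvalue ij k) (Fin.remQuot-combine {suc η} i j))

      -- A profile depends on hub and layer, so the spoke must be the innermost factor. The
      -- numbering of vertices puts the layer last; the swapped pairing moves it to the front.
      eigenvector : Fin (Graph.order G) → Vector Carrier (Graph.order G)
      eigenvector = tensor
        (swap-pairing (remQuot-pairing (suc η ℕ.* suc (suc n)) (suc (suc m))))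
        differences
        (λ k → tensor (remQuot-pairing (suc η) (suc (suc n))) differences (λ i → profile i k))

      module _ (ρ-unit : ∀ i k → Unit (ρ i k)) where

        eigenvector-basis : Basis eigenvector
        eigenvector-basis = tensor-basis
          (swap-pairing (remQuot-pairing (suc η ℕ.* suc (suc n)) (suc (suc m))))
          (differences-basis (suc m))
          (λ k → tensor-basis (remQuot-pairing (suc η) (suc (suc n))) (differences-basis η)
            (λ i → rooted-basis _ _ (κ k)
              (unit-resp (sym (solve 3 (λ a b r →
                  (b :- con ½ :* (a :+ b :- r)) :- (b :- con ½ :* (a :+ b :- :- r)) := r)
                refl (α i k) (β k) (ρ i k))) (ρ-unit i k))
              (completeEigenvalue-unit k)))

      module _ (ρ² : ∀ i k → ρ i k * ρ i k ≈ discriminant i k) where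

        private
          action : Fin (suc η) → Fin (suc (suc m)) →
                   Vector Carrier (suc (suc n)) → Vector Carrier (suc (suc n))
          action i k w a = c * (N + h * atRoot a) * w a -
            κ k * ((sum w - w a) + θ i * (atRoot a * w zero))

          action-zero : ∀ i k w → action i k w zero ≈ α i k * w zero - κ k * (sum w - w zero)
          action-zero i k w = begin
            c * (N + h * 1#) * w zero - κ k * ((sum w - w zero) + θ i * (1# * w zero))
              ≈⟨ +-cong (*-congʳ (*-congˡ (+-congˡ (*-identityʳ h))))
                        (-‿cong (*-congˡ (+-congˡ (*-congˡ (*-identityˡ (w zero)))))) ⟩
            c * (N + h) * w zero - κ k * ((sum w - w zero) + θ i * w zero)
              ≈⟨ solve 5 (λ e κ θ d w → e :* w :- κ :* (d :+ θ :* w) := (e :- κ :* θ) :* w :- κ :* d)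
                   refl (c * (N + h)) (κ k) (θ i) (sum w - w zero) (w zero) ⟩
            α i k * w zero - κ k * (sum w - w zero) ∎

          action-suc : ∀ i k w b →
            action i k w (suc b) ≈ c * N * w (suc b) - κ k * (sum w - w (suc b))
          action-suc i k w b = +-cong
            (*-congʳ (*-congˡ (trans (+-congˡ (zeroʳ h)) (+-identityʳ N))))
            (-‿cong (*-congˡ (trans (+-congˡ (trans (*-congˡ (zeroˡ _)) (zeroʳ _))) (+-identityʳ _))))

          -- (α - λ)(β - λ) - κ²(μ-1) is a quarter of r² minus the discriminant.
          branch-eigen : ∀ i k r (w : Vector Carrier (suc (suc n))) →
            r * r ≈ discriminant i k → w zero ≡ β k - branch i k r → (∀ b → w (suc b) ≡ κ k) →
            ∀ a → action i k w a ≈ branch i k r * w a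
          branch-eigen i k r w r²≈ w₀≡ w₊≡ = λ where
              zero    → begin
                action i k w zero                        ≈⟨ action-zero i k w ⟩
                α i k * w zero - κ k * (sum w - w zero)
                  ≈⟨ +-cong (*-congˡ w₀) (-‿cong (*-congˡ (+-cong ∑w (-‿cong w₀)))) ⟩
                α i k * (β k - branch i k r) -
                  κ k * (β k - branch i k r + N * κ k - (β k - branch i k r))
                  ≈⟨ solve 5 (λ a b κ N r →
                       let l = con ½ :* (a :+ b :- r) in
                       a :* (b :- l) :- κ :* (b :- l :+ N :* κ :- (b :- l)) :=
                       l :* (b :- l) :+ con (+ 1 ℚ./ 4) :*
                         (r :* r :- ((a :- b) :* (a :- b) :+ con (+ 4 ℚ./ 1) :* (κ :* κ :* N))))
                       refl (α i k) (β k) (κ k) N r ⟩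
                branch i k r * (β k - branch i k r) + ⟦ + 1 ℚ./ 4 ⟧ * (r * r - discriminant i k)
                  ≈⟨ +-cong (*-congˡ (sym w₀))
                       (trans (*-congˡ (trans (+-congʳ r²≈) (-‿inverseʳ _))) (zeroʳ _)) ⟩
                branch i k r * w zero + 0#               ≈⟨ +-identityʳ _ ⟩
                branch i k r * w zero                    ∎
              (suc b) → begin
                action i k w (suc b)                     ≈⟨ action-suc i k w b ⟩
                c * N * w (suc b) - κ k * (sum w - w (suc b))
                  ≈⟨ +-cong (*-congˡ (w₊ b)) (-‿cong (*-congˡ (+-cong ∑w (-‿cong (w₊ b))))) ⟩
                c * N * κ k - κ k * (β k - branch i k r + N * κ k - κ k)
                  ≈⟨ solve 4 (λ e κ N l →
                       e :* κ :- κ :* (e :- (N :* κ :- κ) :- l :+ N :* κ :- κ) := l :* κ)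
                       refl (c * N) (κ k) N (branch i k r) ⟩
                branch i k r * κ k                       ≈⟨ *-congˡ (w₊ b) ⟨
                branch i k r * w (suc b)                 ∎
            where
            w₀ : w zero ≈ β k - branch i k r
            w₀ = reflexive w₀≡
            w₊ : ∀ b → w (suc b) ≈ κ k
            w₊ b = reflexive (w₊≡ b)
            ∑w : sum w ≈ β k - branch i k r + N * κ k
            ∑w = +-cong w₀ (trans (sum-cong-≋ w₊) (∑-const (suc n) (κ k)))

          profile-eigen : ∀ i j k a → action i k (profile i k j) a ≈ eigenvalue i j k * profile i k j a
          profile-eigen i zero k =
            branch-eigen i k (ρ i k) _ (ρ² i k) ≡.refl (λ _ → ≡.refl)
          profile-eigen i (suc zero) k =
            branch-eigen i k (- ρ i k) _
              (trans (solve 1 (λ r → (:- r) :* (:- r) := r :* r) refl (ρ i k)) (ρ² i k))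
              ≡.refl (λ _ → ≡.refl)
          profile-eigen i (suc (suc j)) k = λ where
              zero    → begin
                action i k w zero                 ≈⟨ action-zero i k w ⟩
                α i k * 0# - κ k * (sum w - 0#)
                  ≈⟨ +-cong (zeroʳ _) (-‿cong (*-congˡ (trans (+-cong ∑w≈0 -0#≈0#) (+-identityʳ 0#)))) ⟩
                0# - κ k * 0#                     ≈⟨ trans (+-identityˡ _) (-‿cong (zeroʳ _)) ⟩
                - 0#                              ≈⟨ -0#≈0# ⟩
                0#                                ≈⟨ zeroʳ _ ⟨
                (c * N + κ k) * 0#                ∎
              (suc b) → begin
                action i k w (suc b)              ≈⟨ action-suc i k w b ⟩
                c * N * w (suc b) - κ k * (sum w - w (suc b))
                  ≈⟨ solve 4 (λ e κ s w → e :* w :- κ :* (s :- w) := (e :+ κ) :* w :- κ :* s)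
                       refl (c * N) (κ k) (sum w) (w (suc b)) ⟩
                (c * N + κ k) * w (suc b) - κ k * sum w
                  ≈⟨ +-congˡ (trans (-‿cong (trans (*-congˡ ∑w≈0) (zeroʳ _))) -0#≈0#) ⟩
                (c * N + κ k) * w (suc b) + 0#    ≈⟨ +-identityʳ _ ⟩
                (c * N + κ k) * w (suc b)         ∎
            where
            w : Vector Carrier (suc (suc n))
            w = profile i k (suc (suc j))
            ∑w≈0 : sum w ≈ 0#
            ∑w≈0 = trans (+-identityˡ _) (∑-differences j)

        isEigenvector : ∀ s t →
          sum (λ t′ → laplacian G t t′ * eigenvector s t′) ≈ eigenvalues s * eigenvector s t
        isEigenvector s t = begin
          sum (λ t′ → laplacian G t t′ * eigenvector s t′)
            ≈⟨ laplacian-action G t (eigenvector s) ⟩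
          sum (adjacency G t) * eigenvector s t - sum (λ t′ → adjacency G t t′ * eigenvector s t′)
            ≈⟨ +-cong (*-congʳ (degree-action {η} {suc n} {suc m} t))
                 (-‿cong (adjacency-action {suc η} {suc n} {suc (suc m)}
                   (differences-eigen i) (differences-eigen k) w t)) ⟩
          c * (N + h * atRoot a) * (y * (x * w a)) -
            κ k * (y * (x * ((sum w - w a) + θ i * (atRoot a * w zero))))
            ≈⟨ solve 6 (λ e κ y x w d → e :* (y :* (x :* w)) :- κ :* (y :* (x :* d)) :=
                 y :* (x :* (e :* w :- κ :* d))) refl
                 (c * (N + h * atRoot a)) (κ k) y x (w a) _ ⟩
          y * (x * action i k w a)
            ≈⟨ *-congˡ (*-congˡ (profile-eigen i j k a)) ⟩
          y * (x * (eigenvalues s * w a))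
            ≈⟨ solve 4 (λ y x l w → y :* (x :* (l :* w)) := l :* (y :* (x :* w))) refl
                 y x (eigenvalues s) (w a) ⟩
          eigenvalues s * (y * (x * w a)) ∎
          where
          i : Fin (suc η)
          i = hub′ s
          j a : Fin (suc (suc n))
          j = spoke′ s
          a = spoke′ t
          k : Fin (suc (suc m))
          k = layer′ s
          w : Vector Carrier (suc (suc n))
          w = profile i k j
          x y : Carrier
          x = differences i (hub′ t)
          y = differences k (layer′ t)

  -- Integrality and order

  ι-+ : ∀ a b → ι (a ℕ.+ b) ≈ ι a + ι b
  ι-+ zero    b = sym (trans (+-congʳ 0-homo) (+-identityˡ _))
  ι-+ (suc a) b = begin
    ι (suc (a ℕ.+ b))  ≈⟨ ι-suc (a ℕ.+ b) ⟩
    ι (a ℕ.+ b) + 1#   ≈⟨ +-congʳ (ι-+ a b) ⟩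
    ι a + ι b + 1#     ≈⟨ solve 3 (λ a b o → a :+ b :+ o := a :+ o :+ b) refl (ι a) (ι b) 1# ⟩
    ι a + 1# + ι b     ≈⟨ +-congʳ (ι-suc a) ⟨
    ι (suc a) + ι b    ∎

  ι-* : ∀ a b → ι (a ℕ.* b) ≈ ι a * ι b
  ι-* zero    b = trans 0-homo (sym (trans (*-congʳ 0-homo) (zeroˡ _)))
  ι-* (suc a) b = begin
    ι (b ℕ.+ a ℕ.* b)  ≈⟨ trans (ι-+ b (a ℕ.* b)) (+-comm _ _) ⟩
    ι (a ℕ.* b) + ι b  ≈⟨ +-cong (ι-* a b) (sym (*-identityˡ _)) ⟩
    ι a * ι b + 1# * ι b ≈⟨ distribʳ (ι b) (ι a) 1# ⟨
    (ι a + 1#) * ι b   ≈⟨ *-congʳ (ι-suc a) ⟨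
    ι (suc a) * ι b    ∎

  -- A certificate of nonnegativity that makes sense without an order, hence over ℚ and ℝ alike.
  IsNatural : Carrier → Set
  IsNatural x = ∃ λ n → x ≈ ι n

  natural-resp : ∀ {x y} → x ≈ y → IsNatural x → IsNatural y
  natural-resp x≈y (n , x≈n) = n , trans (sym x≈y) x≈n

  infixl 6 _⊕_
  infixl 7 _⊛_

  _⊕_ : ∀ {x y} → IsNatural x → IsNatural y → IsNatural (x + y)
  (a , x≈a) ⊕ (b , y≈b) = a ℕ.+ b , trans (+-cong x≈a y≈b) (sym (ι-+ a b))

  _⊛_ : ∀ {x y} → IsNatural x → IsNatural y → IsNatural (x * y)
  (a , x≈a) ⊛ (b , y≈b) = a ℕ.* b , trans (*-cong x≈a y≈b) (sym (ι-* a b))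

  natural : ∀ n → IsNatural (ι n)
  natural n = n , refl

  ι-∸ : ∀ {a b} → a ℕ.≤ b → IsNatural (ι b - ι a)
  ι-∸ {a} {b} a≤b = b ℕ.∸ a , (begin
    ι b - ι a                  ≈⟨ +-congʳ (reflexive (≡.cong ι (≡.sym (ℕ.m+[n∸m]≡n a≤b)))) ⟩
    ι (a ℕ.+ (b ℕ.∸ a)) - ι a  ≈⟨ +-congʳ (ι-+ a (b ℕ.∸ a)) ⟩
    ι a + ι (b ℕ.∸ a) - ι a    ≈⟨ solve 2 (λ a d → a :+ d :- a := d) refl (ι a) _ ⟩
    ι (b ℕ.∸ a)                ∎)

  -- Comparisons of eigenvalues are linear in the square roots; the coefficients reduce to
  -- multiplication by `ι n` and by ½.
  record Cone : Set₁ where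
    field
      NonNeg : Carrier → Set
      resp   : ∀ {x y} → x ≈ y → NonNeg x → NonNeg y
      0≤0    : NonNeg 0#
      0≤1    : NonNeg 1#
      add    : ∀ {x y} → NonNeg x → NonNeg y → NonNeg (x + y)
      halve  : ∀ {x} → NonNeg x → NonNeg (⟦ ½ ⟧ * x)

    scale-ι : ∀ n {x} → NonNeg x → NonNeg (ι n * x)
    scale-ι zero    {x} 0≤x = resp (sym (trans (*-congʳ 0-homo) (zeroˡ x))) 0≤0
    scale-ι (suc n) {x} 0≤x = resp (begin
      ι n * x + x       ≈⟨ +-congˡ (*-identityˡ x) ⟨
      ι n * x + 1# * x  ≈⟨ distribʳ x (ι n) 1# ⟨
      (ι n + 1#) * x    ≈⟨ *-congʳ (ι-suc n) ⟨
      ι (suc n) * x     ∎) (add (scale-ι n 0≤x) 0≤x)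

    natural-nonNeg : ∀ {x} → IsNatural x → NonNeg x
    natural-nonNeg (n , x≈n) = resp (trans (*-identityʳ (ι n)) (sym x≈n)) (scale-ι n 0≤1)

  -- Comparison of the eigenvalues

  module Bounds (η n m : ℕ) where

    open Spectrum η n m

    ι[1+m]-1 : ∀ k → ι (suc k) - 1# ≈ ι k
    ι[1+m]-1 k = trans (+-congʳ (ι-suc k)) (solve 2 (λ x o → x :+ o :- o := x) refl (ι k) 1#)

    ι-suc′ : ∀ k → ι (suc k) ≈ ι k + ⟦ 1ℚ ⟧
    ι-suc′ k = trans (ι-suc k) (+-congˡ (sym 1-homo))

    total : Carrier
    total = ι (suc (suc n)) + ι (suc η)

    total-expand : total ≈ N + h + ⟦ + 2 ℚ./ 1 ⟧
    total-expand = trans (+-cong (ι-suc′ (suc n)) (ι-suc′ η))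
      (solve 2 (λ N h → (N :+ con 1ℚ) :+ (h :+ con 1ℚ) := N :+ h :+ con (+ 2 ℚ./ 1)) refl N h)

    radicand : Carrier
    radicand = total * total - ι 4 * ι (suc η)

    -- In the shifted sizes the terms `4 h` cancel. The result shows that the radicand is
    -- nonnegative and that its root is at least `N + h`.
    radicand-expand : radicand ≈ (N + h) * (N + h) + ι 4 * N
    radicand-expand = trans
      (+-cong (*-cong total-expand total-expand) (-‿cong (*-congˡ (ι-suc′ η))))
      (solve 2 (λ N h →
        (N :+ h :+ con (+ 2 ℚ./ 1)) :* (N :+ h :+ con (+ 2 ℚ./ 1))
          :- con (+ 4 ℚ./ 1) :* (h :+ con 1ℚ) :=
        (N :+ h) :* (N :+ h) :+ con (+ 4 ℚ./ 1) :* N) refl N h)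

    -- T - 2c, where T is the trace of the matrix.
    excess : Fin (suc η) → Fin (suc m) → Carrier
    excess i k = α i (suc k) + β (suc k) - (c + c)

    private
      c-1 : IsNatural (c - ⟦ 1ℚ ⟧)
      c-1 = ι-∸ {1} {suc m} (ℕ.s≤s ℕ.z≤n)

      N-2 : 1 ℕ.≤ n → IsNatural (N - ⟦ + 2 ℚ./ 1 ⟧)
      N-2 1≤n = ι-∸ {2} (ℕ.s≤s 1≤n)

    module _ (2≤η : 2 ℕ.≤ η) (1≤n : 1 ℕ.≤ n) where

      private
        x-natural : IsNatural (N - ⟦ + 2 ℚ./ 1 ⟧)
        x-natural = N-2 1≤n

        y-natural : IsNatural (c - ⟦ 1ℚ ⟧)
        y-natural = c-1

        z-natural : IsNatural (h - ⟦ + 2 ℚ./ 1 ⟧)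
        z-natural = ι-∸ 2≤η

        v-natural : IsNatural ((c - ⟦ 1ℚ ⟧ + ι 2) * (N - ⟦ + 2 ℚ./ 1 ⟧ + ι 1))
        v-natural = (y-natural ⊕ natural 2) ⊛ (x-natural ⊕ natural 1)

      excess-natural : ∀ i k → IsNatural (excess i k)
      excess-natural zero k = natural-resp
        (solve 3 (λ c N h →
          let y = c :- con 1ℚ ; x = N :- con (+ 2 ℚ./ 1) ; z = h :- con (+ 2 ℚ./ 1)
              κ = :- con 1ℚ in
          (y :+ con (+ 1 ℚ./ 1)) :* (x :+ x :+ z :+ con (+ 4 ℚ./ 1)) :+ x
            :+ (z :+ con (+ 3 ℚ./ 1)) :=
          (c :* (N :+ h) :- κ :* h) :+ (c :* N :- (N :* κ :- κ)) :- (c :+ c)) refl c N h)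
        ((y-natural ⊕ natural 1) ⊛ (x-natural ⊕ x-natural ⊕ z-natural ⊕ natural 4) ⊕ x-natural ⊕ (z-natural ⊕ natural 3))
      excess-natural (suc _) k = natural-resp
        (solve 3 (λ c N h →
          let y = c :- con 1ℚ ; x = N :- con (+ 2 ℚ./ 1) ; z = h :- con (+ 2 ℚ./ 1)
              κ = :- con 1ℚ in
          (y :+ con (+ 1 ℚ./ 1)) :* (x :+ x :+ z :+ con (+ 4 ℚ./ 1)) :+ x :=
          (c :* (N :+ h) :- κ :* κ) :+ (c :* N :- (N :* κ :- κ)) :- (c :+ c)) refl c N h)
        ((y-natural ⊕ natural 1) ⊛ (x-natural ⊕ x-natural ⊕ z-natural ⊕ natural 4) ⊕ x-natural)

      -- The difference is four times the characteristic polynomial at `c`, that is 4((α - c)(β - c)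
      -- - κ²N). Here `v` is β - c, and for θ = -1 the factor α - c is 2 plus the factor multiplying
      -- `v`; the resulting 2v absorbs κ²N = x + 2. For θ = h, α - c grows by h + 1 = z + 3.
      excess²-natural : ∀ i k →
        IsNatural (excess i k * excess i k - discriminant i (suc k))
      excess²-natural zero k = natural-resp
        (solve 3 (λ c N h →
          let y = c :- con 1ℚ ; x = N :- con (+ 2 ℚ./ 1) ; z = h :- con (+ 2 ℚ./ 1)
              κ = :- con 1ℚ
              α = c :* (N :+ h) :- κ :* h
              β = c :* N :- (N :* κ :- κ)
              e = α :+ β :- (c :+ c)
              v = (y :+ con (+ 2 ℚ./ 1)) :* (x :+ con (+ 1 ℚ./ 1)) in
          con (+ 4 ℚ./ 1) :* ((x :+ z :+ y :* (x :+ z :+ con (+ 3 ℚ./ 1))) :* v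
            :+ con (+ 2 ℚ./ 1) :* y :* (x :+ con (+ 1 ℚ./ 1)) :+ con (+ 3 ℚ./ 1) :* x
            :+ con (+ 2 ℚ./ 1) :+ (z :+ con (+ 3 ℚ./ 1)) :* v) :=
          e :* e :- ((α :- β) :* (α :- β) :+ con (+ 4 ℚ./ 1) :* (κ :* κ :* N))) refl c N h)
        (natural 4 ⊛ ((x-natural ⊕ z-natural ⊕ y-natural ⊛ (x-natural ⊕ z-natural ⊕ natural 3)) ⊛ v-natural
          ⊕ natural 2 ⊛ y-natural ⊛ (x-natural ⊕ natural 1) ⊕ natural 3 ⊛ x-natural
          ⊕ natural 2 ⊕ (z-natural ⊕ natural 3) ⊛ v-natural))
      excess²-natural (suc _) k = natural-resp
        (solve 3 (λ c N h →
          let y = c :- con 1ℚ ; x = N :- con (+ 2 ℚ./ 1) ; z = h :- con (+ 2 ℚ./ 1)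
              κ = :- con 1ℚ
              α = c :* (N :+ h) :- κ :* κ
              β = c :* N :- (N :* κ :- κ)
              e = α :+ β :- (c :+ c)
              v = (y :+ con (+ 2 ℚ./ 1)) :* (x :+ con (+ 1 ℚ./ 1)) in
          con (+ 4 ℚ./ 1) :* ((x :+ z :+ y :* (x :+ z :+ con (+ 3 ℚ./ 1))) :* v
            :+ con (+ 2 ℚ./ 1) :* y :* (x :+ con (+ 1 ℚ./ 1)) :+ con (+ 3 ℚ./ 1) :* x
            :+ con (+ 2 ℚ./ 1)) :=
          e :* e :- ((α :- β) :* (α :- β) :+ con (+ 4 ℚ./ 1) :* (κ :* κ :* N))) refl c N h)
        (natural 4 ⊛ ((x-natural ⊕ z-natural ⊕ y-natural ⊛ (x-natural ⊕ z-natural ⊕ natural 3)) ⊛ v-natural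
          ⊕ natural 2 ⊛ y-natural ⊛ (x-natural ⊕ natural 1) ⊕ natural 3 ⊛ x-natural ⊕ natural 2))

    module _ (r : Carrier) (t : Fin (suc η) → Fin (suc m) → Carrier) where

      open Eigenvalues r t

      ρ²≈discriminant : r * r ≈ radicand → (∀ i k → t i k * t i k ≈ discriminant i (suc k)) →
        ∀ i k → ρ i k * ρ i k ≈ discriminant i k
      ρ²≈discriminant r² t² zero    zero    =
        solve 3 (λ c N h →
          (c :* (N :+ con 1ℚ)) :* (c :* (N :+ con 1ℚ)) :=
          let d = (c :* (N :+ h) :- c :* h) :- (c :* N :- (N :* c :- c)) in
          d :* d :+ con (+ 4 ℚ./ 1) :* (c :* c :* N)) refl c N h
      ρ²≈discriminant r² t² (suc _) zero    = begin
        c * r * (c * r)  ≈⟨ solve 2 (λ c r → c :* r :* (c :* r) := c :* c :* (r :* r)) refl c r ⟩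
        c * c * (r * r)  ≈⟨ *-congˡ (trans r² radicand-expand) ⟩
        c * c * ((N + h) * (N + h) + ι 4 * N)
          ≈⟨ solve 3 (λ c N h →
               c :* c :* ((N :+ h) :* (N :+ h) :+ con (+ 4 ℚ./ 1) :* N) :=
               let d = (c :* (N :+ h) :- c :* (:- con 1ℚ)) :- (c :* N :- (N :* c :- c)) in
               d :* d :+ con (+ 4 ℚ./ 1) :* (c :* c :* N)) refl c N h ⟩
        _                ∎
      ρ²≈discriminant r² t² zero    (suc k) = t² zero k
      ρ²≈discriminant r² t² (suc i) (suc k) = t² (suc i) k

      smallest : Fin η → Carrier
      smallest i = eigenvalue (suc i) zero zero

      -- For `κ = c` and `θ = -1` the trace is c(N + h + 2), which is c(μ + η) in the sizes of the
      -- graph, and the root of the discriminant is `c * r`.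
      smallest-formula : ∀ i →
        (ι (suc (suc m)) - 1#) * ((total - r) * ⟦ ½ ⟧) ≈ smallest i
      smallest-formula i = trans
        (*-cong (ι[1+m]-1 (suc m)) (*-congʳ (+-congʳ total-expand)))
        (solve 4 (λ c N h r →
          c :* ((N :+ h :+ con (+ 2 ℚ./ 1) :- r) :* con ½) :=
          con ½ :* ((c :* (N :+ h) :- c :* (:- con 1ℚ)) :+ (c :* N :- (N :* c :- c)) :- c :* r))
          refl c N h r)

      module _ (cone : Cone) where

        open Cone cone

        module _
          (r≤total : NonNeg (total - r)) (N+h≤r : NonNeg (r - (N + h)))
          (0≤r : NonNeg r) (0≤t : ∀ i k → NonNeg (t i k))
          (t≤excess : ∀ i k → NonNeg (excess i k - t i k)) where

          -- c exceeds the smallest eigenvalue by this amount.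
          gap : Carrier
          gap = ⟦ ½ ⟧ * (c * (r - (N + h)))

          0≤gap : NonNeg gap
          0≤gap = halve (scale-ι (suc m) N+h≤r)

          0≤smallest : ∀ i → NonNeg (smallest i - eigenvalue zero zero zero)
          0≤smallest i = resp
            (trans (*-congˡ (*-congˡ (+-congʳ total-expand)))
              (solve 4 (λ c N h r →
                con ½ :* (c :* (N :+ h :+ con (+ 2 ℚ./ 1) :- r)) :=
                con ½ :* ((c :* (N :+ h) :- c :* (:- con 1ℚ)) :+ (c :* N :- (N :* c :- c)) :- c :* r) :-
                con ½ :* ((c :* (N :+ h) :- c :* h) :+ (c :* N :- (N :* c :- c)) :- c :* (N :+ con 1ℚ)))
                refl c N h r))
            (halve (scale-ι (suc m) r≤total))

          smallest-least : 1 ℕ.≤ n → ∀ i₀ i j k → ¬ (i ≡ zero × j ≡ zero × k ≡ zero) →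
            NonNeg (eigenvalue i j k - smallest i₀)
          smallest-least 1≤n i₀ zero    zero          zero    ≢0 = contradiction (≡.refl , ≡.refl , ≡.refl) ≢0
          -- All nonconstant hub vectors share θ = -1, so these are repetitions of the same
          -- eigenvalue.
          smallest-least 1≤n i₀ (suc i) zero          zero    _ = resp (sym (-‿inverseʳ _)) 0≤0
          smallest-least 1≤n i₀ zero    (suc zero)    zero    _ = resp
            (solve 4 (λ c N h r →
              con ½ :* (c :* (r :- (N :+ h))) :+ c :* N :=
              con ½ :* ((c :* (N :+ h) :- c :* h) :+ (c :* N :- (N :* c :- c)) :- :- (c :* (N :+ con 1ℚ)))
              :- con ½ :* ((c :* (N :+ h) :- c :* (:- con 1ℚ)) :+ (c :* N :- (N :* c :- c)) :- c :* r))
              refl c N h r)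
            (add 0≤gap (natural-nonNeg (natural (suc m) ⊛ natural (suc n))))
          -- The conjugate root is compared directly: the difference is `c * r`.
          smallest-least 1≤n i₀ (suc i) (suc zero)    zero    _ = resp
            (solve 2 (λ T x → x := con ½ :* (T :- :- x) :- con ½ :* (T :- x)) refl
              (α (suc i) zero + β zero) (c * r))
            (scale-ι (suc m) 0≤r)
          smallest-least 1≤n i₀ i       (suc (suc j)) zero    _ = resp
            (solve 4 (λ c N h r →
              con ½ :* (c :* (r :- (N :+ h))) :+ c :* N :=
              c :* N :+ c
              :- con ½ :* ((c :* (N :+ h) :- c :* (:- con 1ℚ)) :+ (c :* N :- (N :* c :- c)) :- c :* r))
              refl c N h r)
            (add 0≤gap (natural-nonNeg (natural (suc m) ⊛ natural (suc n))))
          -- With c = y + 1 and N = x + 2, the excess cN - 1 - c over `c` is yx + y + x.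
          smallest-least 1≤n i₀ i       (suc (suc j)) (suc k) _ = resp
            (solve 4 (λ c N h r →
              let y = c :- con 1ℚ ; x = N :- con (+ 2 ℚ./ 1) in
              con ½ :* (c :* (r :- (N :+ h))) :+ (y :* x :+ y :+ x) :=
              c :* N :+ (:- con 1ℚ)
              :- con ½ :* ((c :* (N :+ h) :- c :* (:- con 1ℚ)) :+ (c :* N :- (N :* c :- c)) :- c :* r))
              refl c N h r)
            (add 0≤gap (natural-nonNeg (c-1 ⊛ N-2 1≤n ⊕ c-1 ⊕ N-2 1≤n)))
          smallest-least 1≤n i₀ i       zero          (suc k) _ = resp
            (solve 6 (λ c N h r T t →
              con ½ :* (c :* (r :- (N :+ h))) :+ con ½ :* (T :- (c :+ c) :- t) :=
              con ½ :* (T :- t)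
              :- con ½ :* ((c :* (N :+ h) :- c :* (:- con 1ℚ)) :+ (c :* N :- (N :* c :- c)) :- c :* r))
              refl c N h r (α i (suc k) + β (suc k)) (t i k))
            (add 0≤gap (halve (t≤excess i k)))
          smallest-least 1≤n i₀ i       (suc zero)    (suc k) _ = resp
            (solve 6 (λ c N h r T t →
              con ½ :* (c :* (r :- (N :+ h))) :+ con ½ :* (T :- (c :+ c) :- t) :+ t :=
              con ½ :* (T :- :- t)
              :- con ½ :* ((c :* (N :+ h) :- c :* (:- con 1ℚ)) :+ (c :* N :- (N :* c :- c)) :- c :* r))
              refl c N h r (α i (suc k) + β (suc k)) (t i k))
            (add (add 0≤gap (halve (t≤excess i k))) (0≤t i k))

open import Defs

-- The reals as an ordered commutative ring

module ℚ-Algebra =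
  LinearAlgebra ℚ.+-*-commutativeRing (-raw-almostCommutative⟶ (fromCommutativeRing ℚ.+-*-commutativeRing))

open ℚ-Algebra.Solver using (solve; _:=_; _:+_; _:*_; _:-_; :-_; con)

Eventually : (ℕ → Set) → Set
Eventually P = ∃ λ N → ∀ n → N ≤ℕ n → P n

always : ∀ {P : ℕ → Set} → (∀ n → P n) → Eventually P
always p = 0 , λ n _ → p n

both : ∀ {P Q S : ℕ → Set} → (∀ n → P n → Q n → S n) →
  Eventually P → Eventually Q → Eventually S
both f (M , p) (N , q) = M ℕ.⊔ N , λ n M⊔N≤n →
  f n (p n (ℕ.m⊔n≤o⇒m≤o M N M⊔N≤n)) (q n (ℕ.m⊔n≤o⇒n≤o M N M⊔N≤n))

-- `x ≈ y` unfolds to `Null` of the difference of the sequences, so the congruence laws are closure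
-- properties of null sequences.
Null : (ℕ → ℚ) → Set
Null f = ∀ ε → 0ℚ ℚ.< ε → Eventually λ n → ℚ.∣ f n ∣ ℚ.< ε

null-+ : ∀ f g e → Null f → Null g → (∀ n → e n ≡ f n ℚ.+ g n) → Null e
null-+ f g e f→0 g→0 e≡f+g ε 0<ε = both
  (λ n f<ε/2 g<ε/2 → begin-strict
    ℚ.∣ e n ∣                ≡⟨ ≡.cong ℚ.∣_∣ (e≡f+g n) ⟩
    ℚ.∣ f n ℚ.+ g n ∣        ≤⟨ ℚ.∣p+q∣≤∣p∣+∣q∣ (f n) (g n) ⟩
    ℚ.∣ f n ∣ ℚ.+ ℚ.∣ g n ∣  <⟨ ℚ.+-mono-< f<ε/2 g<ε/2 ⟩
    ½ ℚ.* ε ℚ.+ ½ ℚ.* ε      ≡⟨ half+half ε ⟩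
    ε                        ∎)
  (f→0 (½ ℚ.* ε) (half>0 0<ε)) (g→0 (½ ℚ.* ε) (half>0 0<ε))
  where open ℚ.≤-Reasoning

null-neg : ∀ f g → Null f → (∀ n → g n ≡ ℚ.- f n) → Null g
null-neg f g f→0 g≡-f ε 0<ε with f→0 ε 0<ε
... | N , small = N , λ n N≤n → ≡.subst (ℚ._< ε)
  (≡.sym (≡.trans (≡.cong ℚ.∣_∣ (g≡-f n)) (ℚ.∣-p∣≡∣p∣ (f n)))) (small n N≤n)

null-bounded-* : ∀ x f → Null f → Null (λ n → seq x n ℚ.* f n)
null-bounded-* x f f→0 ε 0<ε with eventually-bounded {seq x} (cauchy x)
... | N , b , 0<b , x<b with divide ε b 0<ε 0<b
... | δ , 0<δ , bδ≡ε = both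
  (λ n x<b f<δ → ≡.subst₂ ℚ._<_ (≡.sym (ℚ.∣p*q∣≡∣p∣*∣q∣ (seq x n) (f n))) bδ≡ε
    (*-bound {seq x n} {b} {f n} 0<b x<b f<δ))
  (N , x<b) (f→0 δ 0<δ)

-- The reals are explicit arguments because `_≈_` unfolds to a statement about sequences, from which
-- the Cauchy proofs cannot be inferred.
≈-pointwise : ∀ x y → (∀ n → seq x n ≡ seq y n) → x ≈ y
≈-pointwise x y x≡y ε 0<ε = always λ n → ≡.subst (ℚ._< ε)
  (≡.sym (≡.cong ℚ.∣_∣ (≡.trans (≡.cong (ℚ._- seq y n) (x≡y n)) (ℚ.+-inverseʳ (seq y n))))) 0<ε

≈-sym : ∀ x y → x ≈ y → y ≈ x
≈-sym x y x≈y =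
  null-neg (λ n → seq x n ℚ.- seq y n) _ x≈y λ n → flip (seq x n) (seq y n)
  where
  flip : ∀ p q → q ℚ.- p ≡ ℚ.- (p ℚ.- q)
  flip = solve 2 (λ p q → q :- p := :- (p :- q)) ≡.refl

≈-trans : ∀ x y z → x ≈ y → y ≈ z → x ≈ z
≈-trans x y z x≈y y≈z = null-+ (λ n → seq x n ℚ.- seq y n) (λ n → seq y n ℚ.- seq z n) _
  x≈y y≈z λ n → split (seq x n) (seq y n) (seq z n)
  where
  split : ∀ p q r → p ℚ.- r ≡ (p ℚ.- q) ℚ.+ (q ℚ.- r)
  split = solve 3 (λ p q r → p :- r := (p :- q) :+ (q :- r)) ≡.refl

+-cong : ∀ x y u v → x ≈ y → u ≈ v → x + u ≈ y + v
+-cong x y u v x≈y u≈v = null-+ (λ n → seq x n ℚ.- seq y n) (λ n → seq u n ℚ.- seq v n) _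
  x≈y u≈v λ n → +-difference (seq x n) (seq u n) (seq y n) (seq v n)

neg-cong : ∀ x y → x ≈ y → - x ≈ - y
neg-cong x y x≈y =
  null-neg (λ n → seq x n ℚ.- seq y n) _ x≈y λ n → neg-difference (seq x n) (seq y n)

*-cong : ∀ x y u v → x ≈ y → u ≈ v → x * u ≈ y * v
*-cong x y u v x≈y u≈v = null-+
  (λ n → seq x n ℚ.* (seq u n ℚ.- seq v n)) (λ n → seq v n ℚ.* (seq x n ℚ.- seq y n)) _
  (null-bounded-* x (λ n → seq u n ℚ.- seq v n) u≈v)
  (null-bounded-* v (λ n → seq x n ℚ.- seq y n) x≈y)
  λ n → *-difference (seq x n) (seq u n) (seq y n) (seq v n)

ℝ-commutativeRing : CommutativeRing 0ℓ 0ℓ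
ℝ-commutativeRing = record
  { Carrier = ℝ ; _≈_ = _≈_ ; _+_ = _+_ ; _*_ = _*_ ; -_ = -_ ; 0# = 0ℝ ; 1# = 1ℝ
  ; isCommutativeRing = record
    { isRing = record
      { +-isAbelianGroup = record
        { isGroup = record
          { isMonoid = record
            { isSemigroup = record
              { isMagma = record
                { isEquivalence = record
                  { refl  = λ {x} → ≈-pointwise x x λ _ → ≡.refl
                  ; sym   = λ {x} {y} → ≈-sym x y
                  ; trans = λ {x} {y} {z} → ≈-trans x y z
                  }
                ; ∙-cong = λ {x} {y} {u} {v} → +-cong x y u v
                }
              ; assoc = λ x y z → ≈-pointwise (x + y + z) (x + (y + z))
                  λ n → ℚ.+-assoc (seq x n) (seq y n) (seq z n)
              }
            ; identity = (λ x → ≈-pointwise (0ℝ + x) x λ n → ℚ.+-identityˡ (seq x n))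
                       , (λ x → ≈-pointwise (x + 0ℝ) x λ n → ℚ.+-identityʳ (seq x n))
            }
          ; inverse = (λ x → ≈-pointwise (- x + x) 0ℝ λ n → ℚ.+-inverseˡ (seq x n))
                    , (λ x → ≈-pointwise (x + - x) 0ℝ λ n → ℚ.+-inverseʳ (seq x n))
          ; ⁻¹-cong = λ {x} {y} → neg-cong x y
          }
        ; comm = λ x y → ≈-pointwise (x + y) (y + x) λ n → ℚ.+-comm (seq x n) (seq y n)
        }
      ; *-cong = λ {x} {y} {u} {v} → *-cong x y u v
      ; *-assoc = λ x y z → ≈-pointwise (x * y * z) (x * (y * z))
          λ n → ℚ.*-assoc (seq x n) (seq y n) (seq z n)
      ; *-identity = (λ x → ≈-pointwise (1ℝ * x) x λ n → ℚ.*-identityˡ (seq x n))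
                   , (λ x → ≈-pointwise (x * 1ℝ) x λ n → ℚ.*-identityʳ (seq x n))
      ; distrib = (λ x y z → ≈-pointwise (x * (y + z)) (x * y + x * z)
                     λ n → ℚ.*-distribˡ-+ (seq x n) (seq y n) (seq z n))
                , (λ x y z → ≈-pointwise ((y + z) * x) (y * x + z * x)
                     λ n → ℚ.*-distribʳ-+ (seq x n) (seq y n) (seq z n))
      }
    ; *-comm = λ x y → ≈-pointwise (x * y) (y * x) λ n → ℚ.*-comm (seq x n) (seq y n)
    }
  }

fromℚ-homomorphism : ℚ.+-*-rawRing -Raw-AlmostCommutative⟶ fromCommutativeRing ℝ-commutativeRing
fromℚ-homomorphism = record
  { ⟦_⟧    = fromℚ
  ; +-homo = λ p q → ≈-pointwise (fromℚ (p ℚ.+ q)) (fromℚ p + fromℚ q) λ _ → ≡.refl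
  ; *-homo = λ p q → ≈-pointwise (fromℚ (p ℚ.* q)) (fromℚ p * fromℚ q) λ _ → ≡.refl
  ; -‿homo = λ p → ≈-pointwise (fromℚ (ℚ.- p)) (- fromℚ p) λ _ → ≡.refl
  ; 0-homo = ≈-pointwise 0ℝ 0ℝ λ _ → ≡.refl
  ; 1-homo = ≈-pointwise 1ℝ 1ℝ λ _ → ≡.refl
  }

module ℝ-Algebra = LinearAlgebra ℝ-commutativeRing fromℚ-homomorphism

-- The order on ℝ

nonNeg-pointwise : ∀ x → (∀ n → 0ℚ ℚ.≤ seq x n) → 0ℝ ≤ x
nonNeg-pointwise x 0≤x ε 0<ε = always λ n → ℚ.+-mono-≤-< (0≤x n) 0<ε

≤-from-difference : ∀ x y → 0ℝ ≤ y - x → x ≤ y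
≤-from-difference x y 0≤y-x ε 0<ε with 0≤y-x ε 0<ε
... | N , 0<y-x+ε = N , λ n N≤n → ≡.subst₂ ℚ._<_ (ℚ.+-identityʳ (seq x n))
  (cancel (seq x n) (seq y n) ε) (ℚ.+-monoʳ-< (seq x n) (0<y-x+ε n N≤n))
  where
  cancel : ∀ p q ε → p ℚ.+ ((q ℚ.- p) ℚ.+ ε) ≡ q ℚ.+ ε
  cancel = solve 3 (λ p q ε → p :+ ((q :- p) :+ ε) := q :+ ε) ≡.refl

nonNeg-resp : ∀ x y → x ≈ y → 0ℝ ≤ x → 0ℝ ≤ y
nonNeg-resp x y x≈y 0≤x ε 0<ε = both
  (λ n close 0<x+ε/2 → begin-strict
    0ℚ                                      <⟨ 0<x+ε/2 ⟩
    seq x n ℚ.+ ½ ℚ.* ε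
      <⟨ ℚ.+-monoˡ-< (½ ℚ.* ε) (difference<⇒< {seq x n} {seq y n}
           (ℚ.≤-<-trans (p≤∣p∣ (seq x n ℚ.- seq y n)) close)) ⟩
    seq y n ℚ.+ ½ ℚ.* ε ℚ.+ ½ ℚ.* ε         ≡⟨ ℚ.+-assoc (seq y n) _ _ ⟩
    seq y n ℚ.+ (½ ℚ.* ε ℚ.+ ½ ℚ.* ε)       ≡⟨ ≡.cong (seq y n ℚ.+_) (half+half ε) ⟩
    seq y n ℚ.+ ε                           ∎)
  (x≈y (½ ℚ.* ε) (half>0 0<ε)) (0≤x (½ ℚ.* ε) (half>0 0<ε))
  where open ℚ.≤-Reasoning

nonNeg-+ : ∀ x y → 0ℝ ≤ x → 0ℝ ≤ y → 0ℝ ≤ x + y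
nonNeg-+ x y 0≤x 0≤y ε 0<ε = both
  (λ n 0<x+ε/2 0<y+ε/2 → ≡.subst (0ℚ ℚ.<_)
    (≡.trans (regroup (seq x n) (seq y n) (½ ℚ.* ε))
             (≡.cong (seq x n ℚ.+ seq y n ℚ.+_) (half+half ε)))
    (ℚ.+-mono-< 0<x+ε/2 0<y+ε/2))
  (0≤x (½ ℚ.* ε) (half>0 0<ε)) (0≤y (½ ℚ.* ε) (half>0 0<ε))
  where
  regroup : ∀ p q e → (p ℚ.+ e) ℚ.+ (q ℚ.+ e) ≡ (p ℚ.+ q) ℚ.+ (e ℚ.+ e)
  regroup = solve 3 (λ p q e → (p :+ e) :+ (q :+ e) := (p :+ q) :+ (e :+ e)) ≡.refl

nonNeg-half : ∀ x → 0ℝ ≤ x → 0ℝ ≤ fromℚ ½ * x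
nonNeg-half x 0≤x ε 0<ε with 0≤x (ε ℚ.+ ε) (ℚ.+-mono-< 0<ε 0<ε)
... | N , 0<x+2ε = N , λ n N≤n →
  ≡.subst₂ ℚ._<_ (ℚ.*-zeroʳ ½) (distribute (seq x n) ε) (ℚ.*-monoʳ-<-pos ½ (0<x+2ε n N≤n))
  where
  distribute : ∀ p e → ½ ℚ.* (p ℚ.+ (e ℚ.+ e)) ≡ ½ ℚ.* p ℚ.+ e
  distribute = solve 2 (λ p e → con ½ :* (p :+ (e :+ e)) := con ½ :* p :+ e) ≡.refl

-- Square roots of rationals

square-cancel-< : ∀ {p q} → 0ℚ ℚ.≤ q → p ℚ.* p ℚ.< q ℚ.* q → p ℚ.< q
square-cancel-< {p} {q} 0≤q p²<q² with p ℚ.<? q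
... | yes p<q = p<q
... | no  p≮q = contradiction (ℚ.<-≤-trans p²<q² (square-mono 0≤q (ℚ.≮⇒≥ p≮q))) (ℚ.<-irrefl ≡.refl)

square-cancel-≤ : ∀ {p q} → 0ℚ ℚ.≤ q → p ℚ.* p ℚ.≤ q ℚ.* q → p ℚ.≤ q
square-cancel-≤ {p} {q} 0≤q p²≤q² with p ℚ.≤? q
... | yes p≤q = p≤q
... | no  p≰q = contradiction (ℚ.≤-<-trans p²≤q² (ℚ.≤-<-trans
  (ℚ.*-monoˡ-≤-nonNeg q {{ℚ.nonNegative 0≤q}} (ℚ.<⇒≤ q<p))
  (ℚ.*-monoˡ-<-pos p {{ℚ.positive (ℚ.≤-<-trans 0≤q q<p)}} q<p))) (ℚ.<-irrefl ≡.refl)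
  where
  q<p : q ℚ.< p
  q<p = ℚ.≰⇒> p≰q

lowerRoot-≤ : ∀ {q r} → r ≡ 0ℚ ⊎ r ℚ.* r ℚ.≤ q →
  ∀ a → 0ℚ ℚ.≤ a → q ℚ.≤ a ℚ.* a → r ℚ.≤ a
lowerRoot-≤         (inj₁ ≡.refl) a 0≤a q≤a² = 0≤a
lowerRoot-≤ {q} {r} (inj₂ r²≤q)   a 0≤a q≤a² = square-cancel-≤ {r} {a} 0≤a (ℚ.≤-trans r²≤q q≤a²)

lowerRoot-square : ∀ {q r} → r ≡ 0ℚ ⊎ r ℚ.* r ℚ.≤ q → 0ℚ ℚ.≤ q → r ℚ.* r ℚ.≤ q
lowerRoot-square (inj₁ ≡.refl) 0≤q = 0≤q
lowerRoot-square (inj₂ r²≤q)   0≤q = r²≤q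

-- `r + d` squares to more than `q`, so `r` falls short of any such `a` by less than the mesh `d`.
upperRoot-≥ : ∀ {q r d e} a → 0ℚ ℚ.≤ r → 0ℚ ℚ.≤ d → q ℚ.< (r ℚ.+ d) ℚ.* (r ℚ.+ d) →
  a ℚ.* a ℚ.≤ q → d ℚ.≤ e → 0ℚ ℚ.< r ℚ.- a ℚ.+ e
upperRoot-≥ {q} {r} {d} {e} a 0≤r 0≤d upper a²≤q d≤e = begin-strict
  0ℚ               ≡⟨ ℚ.+-inverseʳ a ⟨
  a ℚ.- a          <⟨ ℚ.+-monoˡ-< (ℚ.- a) (square-cancel-< {a} {r ℚ.+ d}
                        (ℚ.+-mono-≤ 0≤r 0≤d) (ℚ.≤-<-trans a²≤q upper)) ⟩
  r ℚ.+ d ℚ.- a    ≤⟨ ℚ.+-monoˡ-≤ (ℚ.- a) (ℚ.+-monoʳ-≤ r d≤e) ⟩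
  r ℚ.+ e ℚ.- a    ≡⟨ regroup r e a ⟩
  r ℚ.- a ℚ.+ e    ∎
  where
  open ℚ.≤-Reasoning
  regroup : ∀ r e a → r ℚ.+ e ℚ.- a ≡ r ℚ.- a ℚ.+ e
  regroup = solve 3 (λ r e a → r :+ e :- a := r :- a :+ e) ≡.refl

-- Since (r + d)² = r² + (2r + d)d, the error is at most (2b + 1)δ for every bound `b` of `r`.
upperRoot-square : ∀ {q r d δ b} → 0ℚ ℚ.≤ b → r ℚ.≤ b → 0ℚ ℚ.≤ d → d ℚ.≤ 1ℚ → d ℚ.≤ δ →
  q ℚ.< (r ℚ.+ d) ℚ.* (r ℚ.+ d) → q ℚ.< r ℚ.* r ℚ.+ (b ℚ.+ b ℚ.+ 1ℚ) ℚ.* δ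
upperRoot-square {q} {r} {d} {δ} {b} 0≤b r≤b 0≤d d≤1 d≤δ upper = begin-strict
  q                                   <⟨ upper ⟩
  (r ℚ.+ d) ℚ.* (r ℚ.+ d)             ≡⟨ expand r d ⟩
  r ℚ.* r ℚ.+ (r ℚ.+ r ℚ.+ d) ℚ.* d
    ≤⟨ ℚ.+-monoʳ-≤ (r ℚ.* r) (ℚ.≤-trans
         (ℚ.*-monoʳ-≤-nonNeg d {{ℚ.nonNegative 0≤d}}
           (ℚ.+-mono-≤ (ℚ.+-mono-≤ r≤b r≤b) d≤1))
         (ℚ.*-monoˡ-≤-nonNeg (b ℚ.+ b ℚ.+ 1ℚ)
           {{ℚ.nonNegative (ℚ.+-mono-≤ (ℚ.+-mono-≤ 0≤b 0≤b) (ℚ.nonNegative⁻¹ 1ℚ))}} d≤δ)) ⟩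
  r ℚ.* r ℚ.+ (b ℚ.+ b ℚ.+ 1ℚ) ℚ.* δ  ∎
  where
  open ℚ.≤-Reasoning
  expand : ∀ r d → (r ℚ.+ d) ℚ.* (r ℚ.+ d) ≡ r ℚ.* r ℚ.+ (r ℚ.+ r ℚ.+ d) ℚ.* d
  expand = solve 2 (λ r d → (r :+ d) :* (r :+ d) := r :* r :+ (r :+ r :+ d) :* d) ≡.refl

p≤[p+1]² : ∀ {p} → 0ℚ ℚ.≤ p → p ℚ.≤ (p ℚ.+ 1ℚ) ℚ.* (p ℚ.+ 1ℚ)
p≤[p+1]² {p} 0≤p = begin
  p                            ≤⟨ p≤p+q p (ℚ.+-mono-≤ (ℚ.nonNegative⁻¹ (p ℚ.* p) {{p*p-nonNeg}})
                                    (ℚ.+-mono-≤ 0≤p (ℚ.nonNegative⁻¹ 1ℚ))) ⟩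
  p ℚ.+ (p ℚ.* p ℚ.+ (p ℚ.+ 1ℚ)) ≡⟨ factor p ⟩
  (p ℚ.+ 1ℚ) ℚ.* (p ℚ.+ 1ℚ)    ∎
  where
  open ℚ.≤-Reasoning
  p*p-nonNeg : ℚ.NonNegative (p ℚ.* p)
  p*p-nonNeg = ℚ.nonNeg*nonNeg⇒nonNeg p {{ℚ.nonNegative 0≤p}} p {{ℚ.nonNegative 0≤p}}
  factor : ∀ p → p ℚ.+ (p ℚ.* p ℚ.+ (p ℚ.+ 1ℚ)) ≡ (p ℚ.+ 1ℚ) ℚ.* (p ℚ.+ 1ℚ)
  factor = solve 1 (λ p → p :+ (p :* p :+ (p :+ con 1ℚ)) := (p :+ con 1ℚ) :* (p :+ con 1ℚ)) ≡.refl

module _ (q : ℚ) where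

  √-nonNeg : 0ℝ ≤ √ (fromℚ q)
  √-nonNeg = nonNeg-pointwise (√ (fromℚ q)) λ n → approxRoot≥0 n q

  √-≤ : ∀ a → 0ℚ ℚ.≤ a → q ℚ.≤ a ℚ.* a → 0ℝ ≤ fromℚ a - √ (fromℚ q)
  √-≤ a 0≤a q≤a² = nonNeg-pointwise (fromℚ a - √ (fromℚ q)) λ n →
    p≤q⇒0≤q-p (lowerRoot-≤ {q} {approxRoot n q} (approxRoot-lower n q) a 0≤a q≤a²)
    where
    p≤q⇒0≤q-p : ∀ {p q} → p ℚ.≤ q → 0ℚ ℚ.≤ q ℚ.- p
    p≤q⇒0≤q-p {p} {q} p≤q =
      ≡.subst (ℚ._≤ q ℚ.- p) (ℚ.+-inverseʳ p) (ℚ.+-monoˡ-≤ (ℚ.- p) p≤q)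

  √-≥ : ∀ a → a ℚ.* a ℚ.≤ q → 0ℝ ≤ √ (fromℚ q) - fromℚ a
  √-≥ a a²≤q ε 0<ε with archimedean 0<ε
  ... | N , mesh≤ε = N , λ n N≤n →
    upperRoot-≥ {q} {approxRoot n q} {mesh n} {ε} a (approxRoot≥0 n q) (ℚ.<⇒≤ (mesh>0 n))
      (approxRoot-upper n q) a²≤q (ℚ.≤-trans (mesh-antitone {N} {n} N≤n) mesh≤ε)

  √-square : 0ℚ ℚ.≤ q → √ (fromℚ q) * √ (fromℚ q) ≈ fromℚ q
  -- The divisor is 2b + 1 with b = q + 1, which bounds all approximations because q ≤ (q + 1)².
  √-square 0≤q ε 0<ε with divide ε ((q ℚ.+ 1ℚ) ℚ.+ (q ℚ.+ 1ℚ) ℚ.+ 1ℚ) 0<ε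
    (ℚ.+-mono-≤-< (ℚ.+-mono-≤ 0≤b 0≤b) (ℚ.positive⁻¹ 1ℚ))
    where
    0≤b : 0ℚ ℚ.≤ q ℚ.+ 1ℚ
    0≤b = ℚ.+-mono-≤ 0≤q (ℚ.nonNegative⁻¹ 1ℚ)
  ... | δ , 0<δ , Bδ≡ε with archimedean 0<δ
  ... | N , mesh≤δ = N , λ n N≤n → ∣-∣-from-both {approxRoot n q ℚ.* approxRoot n q} {q} {ε}
      (ℚ.≤-<-trans (lowerRoot-square {q} {approxRoot n q} (approxRoot-lower n q) 0≤q)
        (≡.subst (ℚ._< q ℚ.+ ε) (ℚ.+-identityʳ q) (ℚ.+-monoʳ-< q 0<ε)))
      (≡.subst (λ e → q ℚ.< approxRoot n q ℚ.* approxRoot n q ℚ.+ e) Bδ≡ε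
        (upperRoot-square {q} {approxRoot n q} {mesh n} {δ} {q ℚ.+ 1ℚ}
          (ℚ.+-mono-≤ 0≤q (ℚ.nonNegative⁻¹ 1ℚ))
          (lowerRoot-≤ {q} {approxRoot n q} (approxRoot-lower n q) (q ℚ.+ 1ℚ)
            (ℚ.+-mono-≤ 0≤q (ℚ.nonNegative⁻¹ 1ℚ)) (p≤[p+1]² 0≤q))
          (ℚ.<⇒≤ (mesh>0 n)) (mesh-antitone {0} {n} ℕ.z≤n)
          (ℚ.≤-trans (mesh-antitone {N} {n} N≤n) mesh≤δ) (approxRoot-upper n q)))

-- The spectrum of W′ η μ ×ᴷ K m

0≤q-p⇒p≤q : ∀ {p q} → 0ℚ ℚ.≤ q ℚ.- p → p ℚ.≤ q
0≤q-p⇒p≤q {p} {q} 0≤q-p = ≡.subst₂ ℚ._≤_ (ℚ.+-identityʳ p) (p+[q-p]≡q p q) (ℚ.+-monoʳ-≤ p 0≤q-p)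

square-nonNeg : ∀ p → 0ℚ ℚ.≤ p ℚ.* p
square-nonNeg p with ℚ.≤-total 0ℚ p
... | inj₁ 0≤p = ℚ.nonNegative⁻¹ (p ℚ.* p)
  {{ℚ.nonNeg*nonNeg⇒nonNeg p {{ℚ.nonNegative 0≤p}} p {{ℚ.nonNegative 0≤p}}}}
... | inj₂ p≤0 = ℚ.nonNegative⁻¹ (p ℚ.* p)
  {{ℚ.nonPos*nonPos⇒nonPos p {{ℚ.nonPositive p≤0}} p {{ℚ.nonPositive p≤0}}}}

naturalℚ-nonNeg : ∀ {q} → ℚ-Algebra.IsNatural q → 0ℚ ℚ.≤ q
naturalℚ-nonNeg (n , ≡.refl) = ℚ.nonNegative⁻¹ (+ n ℚ./ 1) {{ℚ.normalize-nonNeg n 1}}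

cone : ℝ-Algebra.Cone
cone = record
  { NonNeg = 0ℝ ≤_
  ; resp   = λ {x} {y} → nonNeg-resp x y
  ; 0≤0    = nonNeg-pointwise 0ℝ λ _ → ℚ.≤-refl
  ; 0≤1    = nonNeg-pointwise 1ℝ λ _ → ℚ.nonNegative⁻¹ 1ℚ
  ; add    = λ {x} {y} → nonNeg-+ x y
  ; halve  = λ {x} → nonNeg-half x
  }

-- The sizes are η + 2, n + 2 and m + 2, so the two hypotheses say that the first two are at least
-- 3.
module Construction (η n m : ℕ) (1≤η : 1 ≤ℕ η) (1≤n : 1 ≤ℕ n) where

  private
    module Sℚ = ℚ-Algebra.Spectrum (suc η) n m
    module Bℚ = ℚ-Algebra.Bounds (suc η) n m
    module S  = ℝ-Algebra.Spectrum (suc η) n m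
    module B  = ℝ-Algebra.Bounds (suc η) n m

  ι-pos : ∀ k → ℚ.Positive (ℚ-Algebra.ι (suc k))
  ι-pos k = ℚ.normalize-pos (suc k) 1

  discriminant-pos : ∀ i k → ℚ.Positive (Sℚ.discriminant i k)
  discriminant-pos i k = ℚ.nonNeg+pos⇒pos
    ((Sℚ.α i k ℚ.- Sℚ.β k) ℚ.* (Sℚ.α i k ℚ.- Sℚ.β k))
    {{ℚ.nonNegative (square-nonNeg (Sℚ.α i k ℚ.- Sℚ.β k))}}
    ((+ 4 ℚ./ 1) ℚ.* (Sℚ.κ k ℚ.* Sℚ.κ k ℚ.* Sℚ.N))
    {{ℚ.pos*pos⇒pos (+ 4 ℚ./ 1) (Sℚ.κ k ℚ.* Sℚ.κ k ℚ.* Sℚ.N)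
      {{ℚ.pos*pos⇒pos (Sℚ.κ k ℚ.* Sℚ.κ k) {{κ²-pos k}} Sℚ.N {{ι-pos n}}}}}}
    where
    κ²-pos : ∀ k → ℚ.Positive (Sℚ.κ k ℚ.* Sℚ.κ k)
    κ²-pos zero    = ℚ.pos*pos⇒pos Sℚ.c {{ι-pos m}} Sℚ.c {{ι-pos m}}
    -- Here `κ` is -1, so its square evaluates to 1 and positivity is found by computation.
    κ²-pos (suc _) = _

  -- Splitting on zero and successor lets `completeEigenvalue` evaluate; the real discriminant is
  -- then the constant sequence of the rational one.
  discriminant-real : ∀ i k → fromℚ (Sℚ.discriminant i k) ≈ S.discriminant i k
  discriminant-real i k =
    ≈-pointwise (fromℚ (Sℚ.discriminant i k)) (S.discriminant i k) (agree i k)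
    where
    agree : ∀ i k n → Sℚ.discriminant i k ≡ seq (S.discriminant i k) n
    agree zero    zero    _ = ≡.refl
    agree zero    (suc _) _ = ≡.refl
    agree (suc _) zero    _ = ≡.refl
    agree (suc _) (suc _) _ = ≡.refl

  r : ℝ
  r = √ (fromℚ Bℚ.radicand)

  t : Fin (suc (suc η)) → Fin (suc m) → ℝ
  t i k = √ (fromℚ (Sℚ.discriminant i (suc k)))

  private
    module E = S.Eigenvalues r t

  0≤radicand : 0ℚ ℚ.≤ Bℚ.radicand
  0≤radicand = ≡.subst (0ℚ ℚ.≤_) (≡.sym Bℚ.radicand-expand) (ℚ.+-mono-≤
    (square-nonNeg (Sℚ.N ℚ.+ Sℚ.h))
    (naturalℚ-nonNeg (ℚ-Algebra._⊛_ (ℚ-Algebra.natural 4) (ℚ-Algebra.natural (suc n)))))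

  r² : r * r ≈ B.radicand
  r² = ≈-trans (r * r) (fromℚ Bℚ.radicand) B.radicand (√-square Bℚ.radicand 0≤radicand)
    (≈-pointwise (fromℚ Bℚ.radicand) B.radicand λ _ → ≡.refl)

  t² : ∀ i k → t i k * t i k ≈ S.discriminant i (suc k)
  t² i k = ≈-trans (t i k * t i k) (fromℚ Δ) (S.discriminant i (suc k))
    (√-square Δ (ℚ.<⇒≤ (ℚ.positive⁻¹ Δ {{discriminant-pos i (suc k)}})))
    (discriminant-real i (suc k))
    where
    Δ : ℚ
    Δ = Sℚ.discriminant i (suc k)

  ρ² : ∀ i k → E.ρ i k * E.ρ i k ≈ S.discriminant i k
  ρ² = B.ρ²≈discriminant r t r² t²

  ρ-unit : ∀ i k → ℝ-Algebra.Unit (E.ρ i k)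
  ρ-unit i k = ℝ-Algebra.unit-root {E.ρ i k} {S.discriminant i k} (ρ² i k)
    (ℝ-Algebra.unit-resp {fromℚ (Sℚ.discriminant i k)} {S.discriminant i k}
      (discriminant-real i k)
      (ℝ-Algebra.⟦⟧-unit (Sℚ.discriminant i k)
        {{ℚ.pos⇒nonZero (Sℚ.discriminant i k) {{discriminant-pos i k}}}}))

  isSpectrum : IsSpectrum (laplacian (W′ (suc (suc η)) (suc (suc n)) ×ᴷ K (suc (suc m)))) E.eigenvalues
  isSpectrum = record
    { eigenvector   = E.eigenvector
    ; isBasis       = record
      { independent = ℝ-Algebra.Basis.independent (E.eigenvector-basis ρ-unit)
      ; spanning    = ℝ-Algebra.Basis.spanning (E.eigenvector-basis ρ-unit)
      }
    ; isEigenvector = E.isEigenvector ρ²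
    }

  r≤total : 0ℝ ≤ B.total - r
  r≤total = √-≤ Bℚ.radicand Bℚ.total
    (naturalℚ-nonNeg (ℚ-Algebra._⊕_ (ℚ-Algebra.natural (suc (suc n))) (ℚ-Algebra.natural (suc (suc η)))))
    (0≤q-p⇒p≤q (≡.subst (0ℚ ℚ.≤_) (cancel (Bℚ.total ℚ.* Bℚ.total) 4η)
      (naturalℚ-nonNeg (ℚ-Algebra._⊛_ (ℚ-Algebra.natural 4) (ℚ-Algebra.natural (suc (suc η)))))))
    where
    4η : ℚ
    4η = ℚ-Algebra.ι 4 ℚ.* ℚ-Algebra.ι (suc (suc η))
    cancel : ∀ x y → y ≡ x ℚ.- (x ℚ.- y)
    cancel = solve 2 (λ x y → y := x :- (x :- y)) ≡.refl

  N+h≤r : 0ℝ ≤ r - (S.N + S.h)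
  N+h≤r = √-≥ Bℚ.radicand (Sℚ.N ℚ.+ Sℚ.h)
    (≡.subst ((Sℚ.N ℚ.+ Sℚ.h) ℚ.* (Sℚ.N ℚ.+ Sℚ.h) ℚ.≤_) (≡.sym Bℚ.radicand-expand)
      (p≤p+q _ (naturalℚ-nonNeg (ℚ-Algebra._⊛_ (ℚ-Algebra.natural 4) (ℚ-Algebra.natural (suc n))))))

  t≤excess : ∀ i k → 0ℝ ≤ B.excess i k - t i k
  t≤excess i k = nonNeg-resp (fromℚ (Bℚ.excess i k) - t i k) (B.excess i k - t i k)
    (≈-pointwise (fromℚ (Bℚ.excess i k) - t i k) (B.excess i k - t i k)
      λ n → ≡.cong (ℚ._- seq (t i k) n) (agree i k n))
    (√-≤ (Sℚ.discriminant i (suc k)) (Bℚ.excess i k)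
      (naturalℚ-nonNeg (Bℚ.excess-natural (ℕ.s≤s 1≤η) 1≤n i k))
      (0≤q-p⇒p≤q (naturalℚ-nonNeg (Bℚ.excess²-natural (ℕ.s≤s 1≤η) 1≤n i k))))
    where
    agree : ∀ i k n → Bℚ.excess i k ≡ seq (B.excess i k) n
    agree zero    _ _ = ≡.refl
    agree (suc _) _ _ = ≡.refl

  secondSmallest : SecondSmallest E.eigenvalues (B.smallest r t zero)
  -- The first position carries the eigenvalue 0 of the constant vector, the second the claimed
  -- value.
  secondSmallest = E.position zero zero zero , E.position (suc zero) zero zero ,
    (λ ()) ,
    ≡.subst₂ _≤_ (≡.sym (E.eigenvalues-position zero zero zero)) (≡.sym at-smallest)
      (≤-from-difference (E.eigenvalue zero zero zero) (B.smallest r t zero)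
        (B.0≤smallest r t cone r≤total N+h≤r 0≤r 0≤t t≤excess zero)) ,
    (λ s s≢ → ≡.subst (_≤ E.eigenvalues s) (≡.sym at-smallest)
      (≤-from-difference (B.smallest r t zero) (E.eigenvalues s)
        (B.smallest-least r t cone r≤total N+h≤r 0≤r 0≤t t≤excess 1≤n zero
          (E.hub′ s) (E.spoke′ s) (E.layer′ s)
          λ (i≡0 , j≡0 , k≡0) → s≢ (E.position-decoded i≡0 j≡0 k≡0)))) ,
    ≡.subst (B.smallest r t zero ≈_) (≡.sym at-smallest)
      (≈-pointwise (B.smallest r t zero) (B.smallest r t zero) λ _ → ≡.refl)
    where
    0≤r : 0ℝ ≤ r
    0≤r = √-nonNeg Bℚ.radicand
    0≤t : ∀ i k → 0ℝ ≤ t i k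
    0≤t i k = √-nonNeg (Sℚ.discriminant i (suc k))
    at-smallest : E.eigenvalues (E.position (suc zero) zero zero) ≡ B.smallest r t zero
    at-smallest = E.eigenvalues-position (suc zero) zero zero

secondSmallest-resp : ∀ {n} (λs : Fin n → ℝ) a b → a ≈ b → SecondSmallest λs b → SecondSmallest λs a
secondSmallest-resp λs a b a≈b (i , j , j≢i , i≤j , least , b≈) =
  i , j , j≢i , i≤j , least , ≈-trans a b (λs j) a≈b b≈

theorem12 : ∀ (η μ m : ℕ) → 3 ≤ℕ η → 3 ≤ℕ μ → 2 ≤ℕ m →
    let s = fromℕ μ + fromℕ η in
    IsAlgebraicConnectivity (W′ η μ ×ᴷ K m)
    ((fromℕ m - 1ℝ) * ((s - √ (s * s - fromℕ 4 * fromℕ η)) / 2))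
theorem12 (suc (suc η)) (suc (suc n)) (suc (suc m)) (ℕ.s≤s (ℕ.s≤s 1≤η)) (ℕ.s≤s (ℕ.s≤s 1≤n)) (ℕ.s≤s (ℕ.s≤s _)) =
  eigenvalues , isSpectrum , secondSmallest-resp eigenvalues a (smallest r t zero)
    -- `a` and `a′` have the same sequence by computation, but their radicands carry different
    -- Cauchy proofs.
    (≈-trans a a′ (smallest r t zero) (≈-pointwise a a′ λ _ → ≡.refl) (smallest-formula r t zero))
    secondSmallest
  where
  open Construction η n m 1≤η 1≤n
  open ℝ-Algebra.Bounds (suc η) n m using (smallest; smallest-formula)
  open ℝ-Algebra.Spectrum.Eigenvalues (suc η) n m r t using (eigenvalues)
  s a a′ : ℝ
  s = fromℕ (suc (suc n)) + fromℕ (suc (suc η))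
  a = (fromℕ (suc (suc m)) - 1ℝ) * ((s - √ (s * s - fromℕ 4 * fromℕ (suc (suc η)))) / 2)
  a′ = (fromℕ (suc (suc m)) - 1ℝ) * ((s - r) * fromℚ ½)
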